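{- Let $G$ be a simple $2$-layer graph with $n\ge 4$ vertices and $m\ge\frac{125}{48}n$ edges. Then the crossing number $cr(G)$ satisfies $$cr(G)\ \ge\ \frac{4.608}{15.625}\,\frac{m^3}{n^2}\ \approx\ 0.295\,\frac{m^3}{n^2}.$$
   Context: All graphs are finite and simple (no loops or parallel edges). A topological $2$-layer graph is a bipartite graph $G=(U\,\dot\cup\,V,E)$, $E\subseteq U\times V$, drawn in the plane so that the vertices of $U$ and of $V$ are distinct points on two horizontal lines $L_u$ and $L_v$, respectively, and edges are $y$-monotone Jordan arcs; the drawing is assumed simple, i.e. adjacent edges do not cross and independent edges cross at most once. (With vertices $u_1,\dots,u_p$ and $v_1,\dots,v_q$ in left-to-right order along the two lines, edges $(u_i,v_x)$ and $(u_j,v_y)$ with $i<j$ cross if and only if $x>y$.) A $2$-layer graph is a bipartite graph considered with such drawings, and $cr(G)$ denotes the $2$-layer crossing number: the minimum, over all topological $2$-layer graphs with underlying abstract graph $G$, of the number of pairs of crossing edges. The numerical "$\approx$" is only an indication of the value of the constant $4.608/15.625=4608/15625$. -}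

module Defs where

open import Data.Fin using (Fin; zero; suc; _<_)
open import Data.Fin.Properties using (_≟_; _<?_; all?; any?)
open import Data.List using (List; length; filter; allFin; cartesianProduct)
open import Data.List.Properties using (filter-≐)
open import Data.Nat as ℕ using (ℕ; zero; suc; _^_; NonZero; >-nonZero)
open import Data.Nat.Properties as ℕ using (m^n≢0)
open import Data.Product using (∃; ∃-syntax; _×_; _,_; proj₁; map₂)
open import Data.Sum using (inj₁; inj₂)
open import Data.Vec.Functional using ([]; _∷_)
open import Function using (_∘_; id)
open import Relation.Binary.Core using (Rel)
import Relation.Binary.Definitions as B
open import Relation.Binary.PropositionalEquality
  using (_≡_; _≢_; _≗_; refl; sym; trans; cong; subst₂)
open import Relation.Nullary using (Dec; yes; no; ¬_; contradiction)
open import Relation.Nullary.Decidable using (_×-dec_; _⊎-dec_; _→-dec_; ¬?; map′)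
open import Relation.Unary using (Pred; Decidable; _≐_)
open import Level using (0ℓ)

record Graph (n : ℕ) : Set₁ where
  field
    Adj      : Rel (Fin n) 0ℓ
    adj?     : B.Decidable Adj
    adj-sym  : B.Symmetric Adj
    no-loops : ∀ {i} → ¬ Adj i i

  -- Each edge {i , j} is listed once, as the pair (i , j) with i < j.
  edges : List (Fin n × Fin n)
  edges = filter (λ (i , j) → (i <? j) ×-dec adj? i j)
                 (cartesianProduct (allFin n) (allFin n))

  size : ℕ
  size = length edges

data Layer : Set where
  U V : Layer

_≟ᴸ_ : B.DecidableEquality Layer
U ≟ᴸ U = yes refl
U ≟ᴸ V = no λ ()
V ≟ᴸ U = no λ ()
V ≟ᴸ V = yes refl

Proper : ∀ {n} → Graph n → (Fin n → Layer) → Set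
Proper G layer = ∀ i j → Adj i j → layer i ≢ layer j
  where open Graph G

Bipartite : ∀ {n} → Graph n → Set
Bipartite G = ∃[ layer ] Proper G layer

-- In a simple drawing the crossings depend only on the left-to-right orders of
-- the vertices on the two lines, so a drawing is recorded by the line each
-- vertex lies on and its place there.  With n places on each line, every pair
-- of orders arises.
module Layout {n : ℕ} (G : Graph n) (layer : Fin n → Layer) (pos : Fin n → Fin n) where
  open Graph G

  DistinctPoints : Set
  DistinctPoints = ∀ i j → layer i ≡ layer j → pos i ≡ pos j → i ≡ j

  IsDrawing : Set
  IsDrawing = Proper G layer × DistinctPoints

  UVEdge : Pred (Fin n × Fin n) 0ℓ
  UVEdge (u , v) = layer u ≡ U × layer v ≡ V × Adj u v

  uvEdge? : Decidable UVEdge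
  uvEdge? (u , v) = (layer u ≟ᴸ U) ×-dec ((layer v ≟ᴸ V) ×-dec adj? u v)

  uvEdges : List (Fin n × Fin n)
  uvEdges = filter uvEdge? (cartesianProduct (allFin n) (allFin n))

  -- The first edge is the one whose U-endpoint is further left, so each
  -- unordered pair of crossing edges satisfies this in exactly one order.
  Cross : Pred ((Fin n × Fin n) × (Fin n × Fin n)) 0ℓ
  Cross ((u , v) , (u′ , v′)) = pos u < pos u′ × pos v′ < pos v

  cross? : Decidable Cross
  cross? ((u , v) , (u′ , v′)) = (pos u <? pos u′) ×-dec (pos v′ <? pos v)

  crossings : ℕ
  crossings = length (filter cross? (cartesianProduct uvEdges uvEdges))

record Drawing {n : ℕ} (G : Graph n) : Set where
  field
    layer     : Fin n → Layer
    pos       : Fin n → Fin n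
    isDrawing : Layout.IsDrawing G layer pos

  open Layout G layer pos public

IsCrossingNumber : ∀ {n} → Graph n → ℕ → Set
IsCrossingNumber G k =
  (∃[ D ] Drawing.crossings {G = G} D ≡ k) ×
  (∀ (D : Drawing G) → k ℕ.≤ Drawing.crossings D)

private

  least : {P : ℕ → Set} → Decidable P → ∀ k → P k →
          ∃[ m ] (P m × (∀ j → P j → m ℕ.≤ j))
  least P? k p with P? 0
  least P? k       p | yes p₀ = 0 , p₀ , λ _ _ → ℕ.z≤n
  least P? zero    p | no ¬p₀ = contradiction p ¬p₀
  least {P} P? (suc k) p | no ¬p₀ with least (P? ∘ suc) k p
  ... | m , pm , min = suc m , pm , bound
    where
    bound : ∀ j → P j → suc m ℕ.≤ j
    bound zero    q = contradiction q ¬p₀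
    bound (suc j) q = ℕ.s≤s (min j q)

  anyLayer? : {P : Layer → Set} → Decidable P → Dec (∃ P)
  anyLayer? P? = map′ (λ { (inj₁ p) → U , p ; (inj₂ p) → V , p })
                      (λ { (U , p) → inj₁ p ; (V , p) → inj₂ p })
                      (P? U ⊎-dec P? V)

  anyFun? : {A : Set} → ({Q : A → Set} → Decidable Q → Dec (∃ Q)) →
            ∀ n {P : (Fin n → A) → Set} →
            (∀ {f g} → f ≗ g → P f → P g) → Decidable P → Dec (∃ P)
  anyFun? search zero resp P? =
    map′ ([] ,_) (λ (f , p) → resp (λ ()) p) (P? [])
  anyFun? search (suc n) resp P? =
    map′ (λ (a , f , p) → (a ∷ f) , p)
         (λ (f , p) → f zero , f ∘ suc , resp (λ { zero → refl ; (suc _) → refl }) p)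
         (search λ a → anyFun? search n
            (λ e → resp (λ { zero → refl ; (suc i) → e i }))
            (λ f → P? (a ∷ f)))

  module _ {n : ℕ} (G : Graph n) where
    open Graph G

    Realises : ℕ → (Fin n → Layer) → (Fin n → Fin n) → Set
    Realises k l p = Layout.IsDrawing G l p × Layout.crossings G l p ≡ k

    realises? : ∀ k l p → Dec (Realises k l p)
    realises? k l p =
      ((all? λ i → all? λ j → adj? i j →-dec ¬? (l i ≟ᴸ l j)) ×-dec
       (all? λ i → all? λ j → (l i ≟ᴸ l j) →-dec ((p i ≟ p j) →-dec (i ≟ j))))
      ×-dec (Layout.crossings G l p ℕ.≟ k)

    crossings-cong : ∀ {l l′ p p′} → l ≗ l′ → p ≗ p′ →
                     Layout.crossings G l p ≡ Layout.crossings G l′ p′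
    crossings-cong {l} {l′} {p} {p′} l≗ p≗ = cong length (trans
      (filter-≐ (Layout.cross? G l p) (Layout.cross? G l′ p′) cross≐
        (cartesianProduct (Layout.uvEdges G l p) (Layout.uvEdges G l p)))
      (cong (λ es → filter (Layout.cross? G l′ p′) (cartesianProduct es es))
        (filter-≐ (Layout.uvEdge? G l p) (Layout.uvEdge? G l′ p′) edge≐
          (cartesianProduct (allFin n) (allFin n)))))
      where
      cross≐ : Layout.Cross G l p ≐ Layout.Cross G l′ p′
      cross≐ = (λ (a , b) → subst₂ _<_ (p≗ _) (p≗ _) a , subst₂ _<_ (p≗ _) (p≗ _) b)
             , (λ (a , b) → subst₂ _<_ (sym (p≗ _)) (sym (p≗ _)) a
                          , subst₂ _<_ (sym (p≗ _)) (sym (p≗ _)) b)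
      edge≐ : Layout.UVEdge G l p ≐ Layout.UVEdge G l′ p′
      edge≐ = (λ (a , b , e) → trans (sym (l≗ _)) a , trans (sym (l≗ _)) b , e)
            , (λ (a , b , e) → trans (l≗ _) a , trans (l≗ _) b , e)

    realises-resp : ∀ {k l l′ p p′} → l ≗ l′ → p ≗ p′ → Realises k l p → Realises k l′ p′
    realises-resp l≗ p≗ ((proper , distinct) , eq) =
      ( (λ i j a e → proper i j a (trans (l≗ i) (trans e (sym (l≗ j)))))
      , (λ i j e f → distinct i j (trans (l≗ i) (trans e (sym (l≗ j))))
                                  (trans (p≗ i) (trans f (sym (p≗ j))))))
      , trans (sym (crossings-cong l≗ p≗)) eq

    realisable? : Decidable (λ k → ∃[ l ] ∃[ p ] Realises k l p)
    realisable? k = anyFun? anyLayer? n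
      (λ l≗ → map₂ (realises-resp l≗ (λ _ → refl)))
      (λ l → anyFun? any? n (realises-resp (λ _ → refl)) (realises? k l))

crossingNumber-exists : ∀ {n} (G : Graph n) → Bipartite G → ∃ (IsCrossingNumber G)
crossingNumber-exists G (layer , proper)
  with least (realisable? G) (Layout.crossings G layer id)
             (layer , id , (proper , λ _ _ _ e → e) , refl)
... | k , (l , p , d , eq) , min =
  k , (record { layer = l ; pos = p ; isDrawing = d } , eq) ,
  λ D → min _ (Drawing.layer D , Drawing.pos D , Drawing.isDrawing D , refl)

cr : ∀ {n} (G : Graph n) → Bipartite G → ℕ
cr G bip = proj₁ (crossingNumber-exists G bip)

n²-nonZero : ∀ {n} → 4 ℕ.≤ n → NonZero (n ^ 2)
n²-nonZero {n} n≥4 = m^n≢0 n 2 {{>-nonZero (ℕ.≤-trans (ℕ.s≤s ℕ.z≤n) n≥4)}}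

{-# OPTIONS --safe #-}
-- Number the vertices on each of the two lines from the left and regard the edge
-- from the i-th to the j-th vertex as the cell (i , j) of a grid.  Cells (i , j)
-- and (i′ , j′) with i < i′ cross iff j′ < j.  Call i + j the level of a cell: with
-- n vertices there are at most n - 1 levels.  Cells of the same level always
-- cross, and a ≥ 1 cells of level s have at least a + b - (t + 2) crossings with
-- b ≥ 1 cells of level s + t.  As (a choose 2) ≥ 2a - 3, summing over all levels s
-- and over t = 0, 1, 2 gives cr ≥ 6m - 10n; some care is needed since levels may
-- be empty.  Keeping each vertex with probability p = 125n / 48m turns this into
-- p⁴ cr + 10pn ≥ 6p²m, hence cr ≥ (622080 / 1953125) m³ / n², and
-- 622080 / 1953125 > 4608 / 15625.
module Submission where

open import Defs

module Counting where

  import Algebra.Properties.CommutativeSemigroup as CommutativeSemigroup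
  open import Data.Bool using (Bool; true; false; if_then_else_; T; T?)
  open import Data.Fin as Fin using (Fin; zero; suc; toℕ; fromℕ<)
  import Data.Fin.Properties as Fin
  open import Data.List using (List; []; _∷_; _++_; length; map; filter; upTo; allFin; cartesianProduct)
  open import Data.List.Extrema.Nat using (min≤⊤; min≤xs; xs≤max; ⊥≤max; argmin-sel; argmax-sel)
  open import Data.List.Membership.Propositional using (_∈_)
  open import Data.List.Membership.Propositional.Properties
    using (∈-upTo⁺; ∈-filter⁻; ∈-map⁻; ∈-allFin)
  open import Data.List.Properties using (map-++; map-∘; length-map; length-upTo; length-tabulate)
  open import Data.List.Relation.Unary.All as All using (All; []; _∷_)
  open import Data.List.Relation.Unary.AllPairs using ([]; _∷_)
  open import Data.List.Relation.Unary.Any using (here; there)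
  open import Data.List.Relation.Unary.Unique.Propositional using (Unique)
  import Data.List.Relation.Unary.Unique.Propositional.Properties as Unique
  open import Data.Nat
  open import Data.Nat.ListAction using (sum)
  open import Data.Nat.ListAction.Properties using (sum-++)
  open import Data.Nat.Properties
  open import Data.Nat.Tactic.RingSolver using (solve-∀)
  open import Data.Product using (_×_; _,_; proj₁; proj₂)
  open import Data.Sum using (_⊎_; inj₁; inj₂; [_,_]′)
  import Data.Vec.Functional as Vec
  open import Function using (_∘_; id; it)
  open import Level using (0ℓ)
  open import Relation.Binary.Definitions using (Tri; tri<; tri≈; tri>)
  open import Relation.Binary.PropositionalEquality
  open import Relation.Nullary using (Dec; does; yes; no; ¬_; contradiction)
  open import Relation.Nullary.Decidable using (¬?; _×-dec_; _⊎-dec_; toWitness)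
  open import Relation.Unary using (Pred; Decidable)

  private
    module +-CS = CommutativeSemigroup +-commutativeSemigroup
    module *-CS = CommutativeSemigroup *-commutativeSemigroup

  private variable
    A B P Q : Set
    n : ℕ

  -- Sums of Iverson brackets

  ⟦_⟧ : Dec P → ℕ
  ⟦ P? ⟧ = if does P? then 1 else 0

  ⟦⟧≤ : ∀ {k} (P? : Dec P) → (P → 1 ≤ k) → ⟦ P? ⟧ ≤ k
  ⟦⟧≤ (no _)  P⇒1≤k = z≤n
  ⟦⟧≤ (yes p) P⇒1≤k = P⇒1≤k p

  ⟦⟧≤1 : (P? : Dec P) → ⟦ P? ⟧ ≤ 1
  ⟦⟧≤1 (no _)  = z≤n
  ⟦⟧≤1 (yes _) = s≤s z≤n

  1≤⟦⟧ : (P? : Dec P) → P → 1 ≤ ⟦ P? ⟧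
  1≤⟦⟧ (yes _) p = s≤s z≤n
  1≤⟦⟧ (no ¬p) p = contradiction p ¬p

  ⟦⟧-mono : (P? : Dec P) (Q? : Dec Q) → (P → Q) → ⟦ P? ⟧ ≤ ⟦ Q? ⟧
  ⟦⟧-mono P? Q? P⇒Q = ⟦⟧≤ P? (1≤⟦⟧ Q? ∘ P⇒Q)

  1≤⟦⟧+⟦⟧ : (P? : Dec P) (Q? : Dec Q) → P ⊎ Q → 1 ≤ ⟦ P? ⟧ + ⟦ Q? ⟧
  1≤⟦⟧+⟦⟧ P? Q? (inj₁ p) = ≤-trans (1≤⟦⟧ P? p) (m≤m+n _ _)
  1≤⟦⟧+⟦⟧ P? Q? (inj₂ q) = ≤-trans (1≤⟦⟧ Q? q) (m≤n+m _ _)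

  ∑ : List A → (A → ℕ) → ℕ
  ∑ xs f = sum (map f xs)

  infixr 6.5 ∑
  syntax ∑ xs (λ x → e) = ∑[ x ← xs ] e

  ∑-mono : ∀ (xs : List A) {f g} → (∀ {x} → x ∈ xs → f x ≤ g x) → ∑ xs f ≤ ∑ xs g
  ∑-mono []       f≤g = z≤n
  ∑-mono (x ∷ xs) f≤g = +-mono-≤ (f≤g (here refl)) (∑-mono xs (f≤g ∘ there))

  ∑-cong : ∀ (xs : List A) {f g} → (∀ x → f x ≡ g x) → ∑ xs f ≡ ∑ xs g
  ∑-cong []       f≡g = refl
  ∑-cong (x ∷ xs) f≡g = cong₂ _+_ (f≡g x) (∑-cong xs f≡g)

  ∑-const : ∀ (xs : List A) k → ∑[ _ ← xs ] k ≡ length xs * k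
  ∑-const []       k = refl
  ∑-const (_ ∷ xs) k = cong (k +_) (∑-const xs k)

  length≡∑1 : ∀ (xs : List A) → length xs ≡ ∑[ _ ← xs ] 1
  length≡∑1 xs = sym (trans (∑-const xs 1) (*-identityʳ _))

  ∑-+ : ∀ (xs : List A) f g → ∑[ x ← xs ] (f x + g x) ≡ ∑ xs f + ∑ xs g
  ∑-+ []       f g = refl
  ∑-+ (x ∷ xs) f g = trans (cong (f x + g x +_) (∑-+ xs f g)) (+-CS.interchange (f x) (g x) _ _)

  ∑-* : ∀ k (xs : List A) {f} → ∑[ x ← xs ] k * f x ≡ k * ∑ xs f
  ∑-* k []       = sym (*-zeroʳ k)
  ∑-* k (x ∷ xs) {f} = trans (cong (k * f x +_) (∑-* k xs)) (sym (*-distribˡ-+ k (f x) _))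

  ∑-swap : ∀ (xs : List A) (ys : List B) {f : A → B → ℕ} →
           ∑[ x ← xs ] ∑[ y ← ys ] f x y ≡ ∑[ y ← ys ] ∑[ x ← xs ] f x y
  ∑-swap []       ys = sym (trans (∑-const ys 0) (*-zeroʳ (length ys)))
  ∑-swap (x ∷ xs) ys {f} = trans (cong (∑ ys (f x) +_) (∑-swap xs ys)) (sym (∑-+ ys (f x) _))

  f≤∑ : ∀ {xs : List A} {x} f → x ∈ xs → f x ≤ ∑ xs f
  f≤∑ f (here refl) = m≤m+n _ _
  f≤∑ f (there x∈)  = ≤-trans (f≤∑ f x∈) (m≤n+m _ _)

  ∑-map : ∀ (g : A → B) xs {f} → ∑ (map g xs) f ≡ ∑ xs (f ∘ g)
  ∑-map g xs = cong sum (sym (map-∘ xs))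

  ∑-++ : ∀ (xs : List A) {ys f} → ∑ (xs ++ ys) f ≡ ∑ xs f + ∑ ys f
  ∑-++ xs {ys} {f} = trans (cong sum (map-++ f xs ys)) (sum-++ (map f xs) (map f ys))

  ∑-cartesianProduct : ∀ (xs : List A) (ys : List B) {f} →
    ∑ (cartesianProduct xs ys) f ≡ ∑[ x ← xs ] ∑[ y ← ys ] f (x , y)
  ∑-cartesianProduct []       ys = refl
  ∑-cartesianProduct (x ∷ xs) ys = trans (∑-++ (map (x ,_) ys))
    (cong₂ _+_ (∑-map (x ,_) ys) (∑-cartesianProduct xs ys))

  module _ {P : Pred A 0ℓ} (P? : Decidable P) where

    ∑-filter : ∀ xs {f} → ∑ (filter P? xs) f ≡ ∑[ x ← xs ] ⟦ P? x ⟧ * f x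
    ∑-filter []       = refl
    ∑-filter (x ∷ xs) {f} with does (P? x)
    ... | true  = cong₂ _+_ (sym (+-identityʳ (f x))) (∑-filter xs)
    ... | false = ∑-filter xs

    length-filter-∑ : ∀ xs → length (filter P? xs) ≡ ∑[ x ← xs ] ⟦ P? x ⟧
    length-filter-∑ []       = refl
    length-filter-∑ (x ∷ xs) with does (P? x)
    ... | true  = cong suc (length-filter-∑ xs)
    ... | false = length-filter-∑ xs

    ∑-split : ∀ xs {f} → ∑ xs f ≡ ∑ (filter P? xs) f + ∑ (filter (¬? ∘ P?) xs) f
    ∑-split []       = refl
    ∑-split (x ∷ xs) {f} with does (P? x)
    ... | true  = trans (cong (f x +_) (∑-split xs)) (sym (+-assoc (f x) _ _))
    ... | false = trans (cong (f x +_) (∑-split xs)) (+-CS.x∙yz≈y∙xz (f x) (∑ (filter P? xs) f) _)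

    filter-¬-absorb : ∀ {Q : Pred A 0ℓ} (Q? : Decidable Q) → (∀ {x} → P x → ¬ Q x) →
                      ∀ xs → filter P? (filter (¬? ∘ Q?) xs) ≡ filter P? xs
    filter-¬-absorb Q? P⇒¬Q [] = refl
    filter-¬-absorb Q? P⇒¬Q (x ∷ xs) with Q? x
    ... | yes q with P? x
    ...   | yes p = contradiction q (P⇒¬Q p)
    ...   | no _  = filter-¬-absorb Q? P⇒¬Q xs
    filter-¬-absorb Q? P⇒¬Q (x ∷ xs) | no _ with does (P? x)
    ... | true  = cong (x ∷_) (filter-¬-absorb Q? P⇒¬Q xs)
    ... | false = filter-¬-absorb Q? P⇒¬Q xs

    length-split : ∀ xs → length xs ≡ ∑[ x ← xs ] ⟦ P? x ⟧ + length (filter (¬? ∘ P?) xs)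
    length-split xs = begin
      length xs                                               ≡⟨ length≡∑1 xs ⟩
      ∑[ _ ← xs ] 1                                           ≡⟨ ∑-split xs ⟩
      ∑[ _ ← filter P? xs ] 1 + ∑[ _ ← filter (¬? ∘ P?) xs ] 1
        ≡⟨ cong₂ _+_ (length≡∑1 (filter P? xs)) (length≡∑1 (filter (¬? ∘ P?) xs)) ⟨
      length (filter P? xs) + length (filter (¬? ∘ P?) xs)
        ≡⟨ cong (_+ length (filter (¬? ∘ P?) xs)) (length-filter-∑ xs) ⟩
      ∑[ x ← xs ] ⟦ P? x ⟧ + length (filter (¬? ∘ P?) xs)     ∎
      where open ≡-Reasoning

  -- Lists of distinct elements.

  Unique-map⁺ : ∀ (f : A → B) {xs} → (∀ {x y} → x ∈ xs → y ∈ xs → f x ≡ f y → x ≡ y) →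
                Unique xs → Unique (map f xs)
  Unique-map⁺ f inj [] = []
  Unique-map⁺ f {x ∷ xs} inj (x∉ ∷ u) =
    fresh xs there x∉ ∷ Unique-map⁺ f (λ y∈ z∈ → inj (there y∈) (there z∈)) u
    where
    fresh : ∀ ys → (∀ {y} → y ∈ ys → y ∈ x ∷ xs) → All (x ≢_) ys → All (f x ≢_) (map f ys)
    fresh []       ys⊆ []         = []
    fresh (y ∷ ys) ys⊆ (x≢y ∷ x∉) =
      x≢y ∘ inj (here refl) (ys⊆ (here refl)) ∷ fresh ys (ys⊆ ∘ there) x∉

  occurrences≤1 : ∀ {xs} → Unique xs → ∀ z → ∑[ x ← xs ] ⟦ x ≟ z ⟧ ≤ 1
  occurrences≤1 [] z = z≤n
  occurrences≤1 {x ∷ xs} (x∉ ∷ u) z = by-cases (x ≟ z)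
    where
    absent : ∑[ y ← xs ] ⟦ y ≟ x ⟧ ≤ 0
    absent = ≤-trans
      (∑-mono xs λ {y} y∈ → ⟦⟧≤ (y ≟ x) λ { refl → contradiction refl (All.lookup x∉ y∈) })
      (≤-reflexive (trans (∑-const xs 0) (*-zeroʳ (length xs))))
    by-cases : Dec (x ≡ z) → ⟦ x ≟ z ⟧ + ∑[ y ← xs ] ⟦ y ≟ z ⟧ ≤ 1
    by-cases (yes refl) = +-mono-≤ {y = 1} (⟦⟧≤1 (x ≟ x)) absent
    by-cases (no x≢z)   = +-mono-≤ {y = 0}
      (⟦⟧≤ (x ≟ z) λ x≡z → contradiction x≡z x≢z) (occurrences≤1 u z)

  -- Pigeonhole by double counting: each entry equals some `l + i` with `i < w`, and by
  -- `occurrences≤1` each `l + i` is met at most once.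
  length≤width : ∀ l w {xs} → Unique xs → (∀ {x} → x ∈ xs → l ≤ x × x < l + w) → length xs ≤ w
  length≤width l w {xs} u within = begin
    length xs                                      ≡⟨ length≡∑1 xs ⟩
    ∑[ _ ← xs ] 1                                  ≤⟨ ∑-mono xs hit ⟩
    ∑[ x ← xs ] ∑[ i ← upTo w ] ⟦ x ≟ l + i ⟧       ≡⟨ ∑-swap xs (upTo w) ⟩
    ∑[ i ← upTo w ] ∑[ x ← xs ] ⟦ x ≟ l + i ⟧       ≤⟨ ∑-mono (upTo w) (λ {i} _ → occurrences≤1 u (l + i)) ⟩
    ∑[ _ ← upTo w ] 1                              ≡⟨ length≡∑1 (upTo w) ⟨
    length (upTo w)                                ≡⟨ length-upTo w ⟩
    w                                              ∎
    where
    open ≤-Reasoning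
    hit : ∀ {x} → x ∈ xs → 1 ≤ ∑[ i ← upTo w ] ⟦ x ≟ l + i ⟧
    hit {x} x∈ with within x∈
    ... | l≤x , x<l+w = ≤-trans (1≤⟦⟧ (x ≟ l + (x ∸ l)) (sym (m+[n∸m]≡n l≤x)))
      (f≤∑ (λ i → ⟦ x ≟ l + i ⟧)
        (∈-upTo⁺ (+-cancelˡ-< l _ _ (subst (_< l + w) (sym (m+[n∸m]≡n l≤x)) x<l+w))))

  -- Far pairs between two levels.

  -- Cells (x , s - x) and (y , s + t - y) cross iff Far t x y.
  Far : ℕ → ℕ → ℕ → Set
  Far t x y = y < x ⊎ x + t < y

  far? : ∀ t x y → Dec (Far t x y)
  far? t x y = (y <? x) ⊎-dec (x + t <? y)

  module _ (t : ℕ) {xs ys : List ℕ} (uxs : Unique xs) (uys : Unique ys) where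

    private
      farPairs : ℕ
      farPairs = ∑[ x ← xs ] ∑[ y ← ys ] ⟦ far? t x y ⟧

    -- At most t + 1 distinct x lie in [y - t , y].
    length≤far : ∀ y → length xs ≤ ∑[ x ← xs ] ⟦ far? t x y ⟧ + suc t
    length≤far y = ≤-trans (≤-reflexive (length-split far xs))
      (+-monoʳ-≤ _ (length≤width (y ∸ t) (suc t) (Unique.filter⁺ (¬? ∘ far) uxs) within))
      where
      far : Decidable (λ x → Far t x y)
      far x = far? t x y
      within : ∀ {x} → x ∈ filter (¬? ∘ far) xs → y ∸ t ≤ x × x < (y ∸ t) + suc t
      within {x} x∈ =
        m≤n+o⇒m∸n≤o y t (subst (y ≤_) (+-comm x t) (≮⇒≥ (¬far ∘ inj₂))) ,
        ≤-trans (s≤s (≤-trans (≮⇒≥ (¬far ∘ inj₁)) (m≤n+m∸n y t)))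
                (≤-reflexive (trans (cong suc (+-comm t (y ∸ t))) (sym (+-suc _ t))))
        where
        ¬far : ¬ Far t x y
        ¬far = proj₂ (∈-filter⁻ (¬? ∘ far) {xs = xs} x∈)

    -- Let a and b be the two lengths. By `length≤far` each `y` is far from at least a - (t + 1)
    -- entries of `xs`, so there are at least b (a - t - 1) far pairs. This exceeds a + b - (t + 2)
    -- by (b - 1) (a - t - 2), where both factors are nonnegative.
    far-long : t + 2 ≤ length xs → 1 ≤ length ys → length xs + length ys ≤ t + 2 + farPairs
    far-long t+2≤a 1≤b = arith (length xs) (length ys) t+2≤a 1≤b (begin
      length ys * length xs                                           ≡⟨ ∑-const ys (length xs) ⟨
      ∑[ _ ← ys ] length xs                                           ≤⟨ ∑-mono ys (λ {y} _ → length≤far y) ⟩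
      ∑[ y ← ys ] (∑[ x ← xs ] ⟦ far? t x y ⟧ + suc t)                ≡⟨ ∑-+ ys _ (λ _ → suc t) ⟩
      (∑[ y ← ys ] ∑[ x ← xs ] ⟦ far? t x y ⟧) + ∑[ _ ← ys ] suc t
        ≡⟨ cong₂ _+_ (∑-swap ys xs) (∑-const ys (suc t)) ⟩
      farPairs + length ys * suc t                                    ∎)
      where
      open ≤-Reasoning
      eq₁ : ∀ t a b → suc b * (t + 2 + a) ≡ (a + b + b * a + 1) + (suc b * suc t)
      eq₁ = solve-∀
      eq₂ : ∀ t a b → t + 2 + a + suc b ≡ t + 2 + (a + b + 1)
      eq₂ = solve-∀
      arith : ∀ a b → t + 2 ≤ a → 1 ≤ b → b * a ≤ farPairs + b * suc t → a + b ≤ t + 2 + farPairs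
      arith a (suc b) t+2≤a _ le with m≤n⇒∃[o]m+o≡n t+2≤a
      ... | k , refl = begin
        t + 2 + k + suc b       ≡⟨ eq₂ t k b ⟩
        t + 2 + (k + b + 1)
          ≤⟨ +-monoʳ-≤ (t + 2) (≤-trans (+-monoˡ-≤ 1 (m≤m+n (k + b) (b * k)))
               (+-cancelʳ-≤ (suc b * suc t) _ _
                 (subst (_≤ farPairs + suc b * suc t) (eq₁ t k b) le))) ⟩
        t + 2 + farPairs        ∎

    -- Every y outside [max xs , min xs + t] is far from an extreme element of xs.
    far-short : ∀ {x₀ x₁} → x₀ ∈ xs → x₁ ∈ xs → (∀ {x} → x ∈ xs → x₀ ≤ x × x ≤ x₁) →
                length xs ≤ t + 1 → length xs + length ys ≤ t + 2 + farPairs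
    far-short {x₀} {x₁} x₀∈ x₁∈ within a≤ = begin
      length xs + length ys                                       ≤⟨ +-monoʳ-≤ (length xs) ys≤ ⟩
      length xs + (farPairs + (suc (x₀ + t) ∸ x₁))                ≡⟨ +-CS.x∙yz≈xz∙y (length xs) farPairs _ ⟩
      length xs + (suc (x₀ + t) ∸ x₁) + farPairs                  ≤⟨ +-monoˡ-≤ farPairs (arith _ a≤ xs≤) ⟩
      t + 2 + farPairs                                            ∎
      where
      open ≤-Reasoning
      far : Decidable (λ y → Far t x₀ y ⊎ Far t x₁ y)
      far y = far? t x₀ y ⊎-dec far? t x₁ y
      between : ∀ {y} → y ∈ filter (¬? ∘ far) ys → x₁ ≤ y × y < x₁ + (suc (x₀ + t) ∸ x₁)
      between {y} y∈ = ≮⇒≥ (¬far ∘ inj₂ ∘ inj₁) ,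
                       ≤-trans (s≤s (≮⇒≥ (¬far ∘ inj₁ ∘ inj₂))) (m≤n+m∸n (suc (x₀ + t)) x₁)
        where
        ¬far : ¬ (Far t x₀ y ⊎ Far t x₁ y)
        ¬far = proj₂ (∈-filter⁻ (¬? ∘ far) {xs = ys} y∈)
      ⟦far⟧≤ : ∀ y → ⟦ far y ⟧ ≤ ∑[ x ← xs ] ⟦ far? t x y ⟧
      ⟦far⟧≤ y = ⟦⟧≤ (far y) λ
        { (inj₁ f) → ≤-trans (1≤⟦⟧ (far? t x₀ y) f) (f≤∑ (λ x → ⟦ far? t x y ⟧) x₀∈)
        ; (inj₂ f) → ≤-trans (1≤⟦⟧ (far? t x₁ y) f) (f≤∑ (λ x → ⟦ far? t x y ⟧) x₁∈) }
      ys≤ : length ys ≤ farPairs + (suc (x₀ + t) ∸ x₁)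
      ys≤ = begin
        length ys                                                     ≡⟨ length-split far ys ⟩
        ∑[ y ← ys ] ⟦ far y ⟧ + length (filter (¬? ∘ far) ys)
          ≤⟨ +-mono-≤ (∑-mono ys (λ {y} _ → ⟦far⟧≤ y))
                      (length≤width x₁ _ (Unique.filter⁺ (¬? ∘ far) uys) between) ⟩
        (∑[ y ← ys ] ∑[ x ← xs ] ⟦ far? t x y ⟧) + (suc (x₀ + t) ∸ x₁) ≡⟨ cong (_+ _) (∑-swap ys xs) ⟩
        farPairs + (suc (x₀ + t) ∸ x₁)                                ∎
      xs≤ : length xs ≤ suc x₁ ∸ x₀
      xs≤ = length≤width x₀ _ uxs λ x∈ →
        proj₁ (within x∈) , ≤-trans (s≤s (proj₂ (within x∈))) (m≤n+m∸n (suc x₁) x₀)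
      -- The widths x₁ - x₀ + 1 and x₀ + t + 1 - x₁ add up to `t + 2`. When the second one is
      -- truncated to 0, `a ≤ t + 1` is used instead.
      arith : ∀ a → a ≤ t + 1 → a ≤ suc x₁ ∸ x₀ → a + (suc (x₀ + t) ∸ x₁) ≤ t + 2
      arith a a≤t+1 a≤d with ≤-total x₁ (suc (x₀ + t))
      ... | inj₂ le = ≤-trans (≤-reflexive (trans (cong (a +_) (m≤n⇒m∸n≡0 le)) (+-identityʳ a)))
                              (≤-trans a≤t+1 (+-monoʳ-≤ t (s≤s z≤n)))
      ... | inj₁ le = +-cancelʳ-≤ (x₀ + x₁) _ _ (begin
        a + (suc (x₀ + t) ∸ x₁) + (x₀ + x₁)   ≡⟨ regroup a _ x₀ x₁ ⟩
        (a + x₀) + (suc (x₀ + t) ∸ x₁ + x₁)   ≤⟨ +-mono-≤ (≤-trans (+-monoˡ-≤ x₀ a≤d)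
                                                   (≤-reflexive (m∸n+n≡m (m≤n⇒m≤1+n (proj₂ (within x₀∈))))))
                                                  (≤-reflexive (m∸n+n≡m le)) ⟩
        suc x₁ + suc (x₀ + t)                 ≡⟨ total x₀ x₁ t ⟩
        t + 2 + (x₀ + x₁)                     ∎)
        where
        regroup : ∀ a b c d → a + b + (c + d) ≡ (a + c) + (b + d)
        regroup = solve-∀
        total : ∀ x₀ x₁ t → suc x₁ + suc (x₀ + t) ≡ t + 2 + (x₀ + x₁)
        total = solve-∀

  -- For nonempty levels this is a + b - (t + 2), truncated at 0. An empty level takes part in no
  -- crossing, so there the value is 0 however long the other level is.
  farBound : ℕ → ℕ → ℕ → ℕ
  farBound t (suc a) (suc b) = a + b ∸ t
  farBound t _       _       = 0

  farBound-mono : ∀ t {a a′ b b′} → a ≤ a′ → b ≤ b′ → farBound t a b ≤ farBound t a′ b′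
  farBound-mono t z≤n        _          = z≤n
  farBound-mono t (s≤s _)    z≤n        = z≤n
  farBound-mono t (s≤s a≤a′) (s≤s b≤b′) = ∸-monoˡ-≤ t (+-mono-≤ a≤a′ b≤b′)

  -- Two arguments are combined. If `xs` has at most t + 1 entries, a single `y` may be far from
  -- none of them and the count per `y` in `far-long` is void; `far-short` then uses the spread of
  -- `xs` between its minimum and maximum.
  farBound≤ : ∀ t {xs ys} → Unique xs → Unique ys →
              farBound t (length xs) (length ys) ≤ ∑[ x ← xs ] ∑[ y ← ys ] ⟦ far? t x y ⟧
  farBound≤ t {[]}              uxs uys = z≤n
  farBound≤ t {_ ∷ _}  {[]}     uxs uys = z≤n
  farBound≤ t {x ∷ xs} {y ∷ ys} uxs uys = m≤n+o⇒m∸n≤o _ t (+-cancelˡ-≤ 2 _ _ (begin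
    2 + (length xs + length ys)                 ≡⟨ shift₂ (length xs) (length ys) ⟩
    length (x ∷ xs) + length (y ∷ ys)           ≤⟨ bound ⟩
    t + 2 + S                                   ≡⟨ rotate t S ⟩
    2 + (t + S)                                 ∎))
    where
    open ≤-Reasoning
    S = ∑[ x ← x ∷ xs ] ∑[ y ← y ∷ ys ] ⟦ far? t x y ⟧
    shift₂ : ∀ a b → 2 + (a + b) ≡ suc a + suc b
    shift₂ = solve-∀
    rotate : ∀ t s → t + 2 + s ≡ 2 + (t + s)
    rotate = solve-∀
    extreme : ∀ {z} → z ≡ x ⊎ z ∈ xs → z ∈ x ∷ xs
    extreme = [ here , there ]′
    bound : length (x ∷ xs) + length (y ∷ ys) ≤ t + 2 + S
    bound with t + 2 ≤? length (x ∷ xs)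
    ... | yes long = far-long t uxs uys long (s≤s z≤n)
    ... | no short = far-short t uxs uys
      (extreme (argmin-sel id x xs)) (extreme (argmax-sel id x xs))
      (λ z∈ → All.lookup (min≤⊤ x xs ∷ min≤xs x xs) z∈ , All.lookup (⊥≤max x xs ∷ xs≤max x xs) z∈)
      (s≤s⁻¹ (≤-trans (≰⇒> short) (≤-reflexive (+-suc t 1))))

  -- The contribution of a single level.

  pairs : ℕ → ℕ
  pairs zero    = 0
  pairs (suc n) = n + pairs n

  -- The contribution of a level with a cells, followed by levels with b and c
  -- cells.  The potential (10 ∸ (a + b)) - a lets full levels pay for empty ones.
  -- It only works for a, b, c ≤ 6, hence the cap below; a seventh cell of a level
  -- crosses six others and so pays for itself.
  StepBound : ℕ → ℕ → ℕ → Set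
  StepBound a b c =
    6 * a + (10 ∸ (a + b)) + b ≤ pairs a + farBound 1 a b + farBound 2 a c + 10 + a + (10 ∸ (b + c))

  -- All 343 triples are checked by evaluation; this finiteness is what the cap at 6 provides.
  stepBound-small : ∀ (a b c : Fin 7) → StepBound (toℕ a) (toℕ b) (toℕ c)
  stepBound-small = toWitness {a? = Fin.all? λ a → Fin.all? λ b → Fin.all? λ c → _ ≤? _} _

  cap : ℕ → ℕ
  cap = _⊓ 6

  -- Here 15 is `pairs 6` and 36 is `6 * cap a` for a = 6 + k, so this is the second case of
  -- `pairs-cap` verbatim. In the induction the left side grows by 6 and the right side by 6 + k.
  15+6k≤pairs : ∀ k → 6 * (6 + k) + 15 ≤ 36 + pairs (6 + k)
  15+6k≤pairs zero    = ≤-refl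
  15+6k≤pairs (suc k) = begin
    6 * (7 + k) + 15               ≡⟨ peel k ⟩
    6 + (6 * (6 + k) + 15)         ≤⟨ +-mono-≤ (m≤m+n 6 k) (15+6k≤pairs k) ⟩
    (6 + k) + (36 + pairs (6 + k)) ≡⟨ +-CS.x∙yz≈y∙xz (6 + k) 36 _ ⟩
    36 + pairs (7 + k)             ∎
    where
    open ≤-Reasoning
    peel : ∀ k → 6 * (7 + k) + 15 ≡ 6 + (6 * (6 + k) + 15)
    peel = solve-∀

  -- As `pairs a` is a choose 2, passing from a to a + 1 changes 6a - `pairs a` by 6 - a. Beyond a =
  -- 6 this difference no longer rises, so capping cannot lower it; terms are moved across to avoid
  -- subtraction.
  pairs-cap : ∀ a → 6 * a + pairs (cap a) ≤ 6 * cap a + pairs a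
  pairs-cap a with ≤-total a 6
  ... | inj₁ a≤6 rewrite m≤n⇒m⊓n≡m a≤6 = ≤-refl
  ... | inj₂ 6≤a rewrite m≥n⇒m⊓n≡n 6≤a with m≤n⇒∃[o]m+o≡n 6≤a
  ...   | k , refl = 15+6k≤pairs k

  -- By `pairs-cap` and `farBound-mono` the inequality for the capped triple implies this one. The
  -- potential itself stays capped, which is why `levels-bound` carries `cap`.
  stepBound : ∀ a b c → 6 * a + (10 ∸ (cap a + cap b)) + cap b ≤
              pairs a + farBound 1 a b + farBound 2 a c + 10 + cap a + (10 ∸ (cap b + cap c))
  stepBound a b c = +-cancelʳ-≤ (pairs â) _ _ (begin
    6 * a + u + b̂ + pairs â                              ≡⟨ e₁ (6 * a) u b̂ (pairs â) ⟩
    (6 * a + pairs â) + (u + b̂)                          ≤⟨ +-monoˡ-≤ (u + b̂) (pairs-cap a) ⟩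
    (6 * â + pairs a) + (u + b̂)                          ≡⟨ e₂ (6 * â) (pairs a) u b̂ ⟩
    pairs a + (6 * â + u + b̂)                            ≤⟨ +-monoʳ-≤ (pairs a) small ⟩
    pairs a + (pairs â + farBound 1 â b̂ + farBound 2 â ĉ + 10 + â + v)
      ≤⟨ +-monoʳ-≤ (pairs a) (+-monoˡ-≤ v (+-monoˡ-≤ â (+-monoˡ-≤ 10 (+-mono-≤ (+-monoʳ-≤ (pairs â)
           (farBound-mono 1 (m⊓n≤m a 6) (m⊓n≤m b 6))) (farBound-mono 2 (m⊓n≤m a 6) (m⊓n≤m c 6)))))) ⟩
    pairs a + (pairs â + farBound 1 a b + farBound 2 a c + 10 + â + v)
      ≡⟨ e₃ (pairs a) (pairs â) (farBound 1 a b) (farBound 2 a c) â v ⟩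
    pairs a + farBound 1 a b + farBound 2 a c + 10 + â + v + pairs â ∎)
    where
    open ≤-Reasoning
    â = cap a
    b̂ = cap b
    ĉ = cap c
    u = 10 ∸ (â + b̂)
    v = 10 ∸ (b̂ + ĉ)
    e₁ : ∀ x u b p → x + u + b + p ≡ (x + p) + (u + b)
    e₁ = solve-∀
    e₂ : ∀ x p u b → (x + p) + (u + b) ≡ p + (x + u + b)
    e₂ = solve-∀
    e₃ : ∀ p q f g a v → p + (q + f + g + 10 + a + v) ≡ p + f + g + 10 + a + v + q
    e₃ = solve-∀
    cap< : ∀ x → cap x < 7
    cap< x = s≤s (m⊓n≤n x 6)
    small : StepBound â b̂ ĉ
    small = subst (StepBound â b̂) (Fin.toℕ-fromℕ< (cap< c))
      (subst₂ (λ x y → StepBound x y (toℕ (fromℕ< (cap< c))))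
        (Fin.toℕ-fromℕ< (cap< a)) (Fin.toℕ-fromℕ< (cap< b))
        (stepBound-small (fromℕ< (cap< a)) (fromℕ< (cap< b)) (fromℕ< (cap< c))))

  -- Crossings of cells

  Cell : Set
  Cell = ℕ × ℕ

  level : Cell → ℕ
  level (i , j) = i + j

  Crosses : Cell → Cell → Set
  Crosses (i , j) (i′ , j′) = i < i′ × j′ < j

  crosses? : ∀ c d → Dec (Crosses c d)
  crosses? (i , j) (i′ , j′) = (i <? i′) ×-dec (j′ <? j)

  crossings : List Cell → ℕ
  crossings P = ∑[ c ← P ] ∑[ d ← P ] ⟦ crosses? c d ⟧

  -- `Crosses` puts the cell with the smaller first coordinate first. That cell may come from either
  -- list, hence both orders are summed.
  crossingsBetween : List Cell → List Cell → ℕ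
  crossingsBetween P Q = ∑[ c ← P ] ∑[ d ← Q ] (⟦ crosses? c d ⟧ + ⟦ crosses? d c ⟧)

  onLevel? : ∀ s → Decidable (λ c → level c ≡ s)
  onLevel? s c = level c ≟ s

  row rest : ℕ → List Cell → List Cell
  row  s = filter (onLevel? s)
  rest s = filter (¬? ∘ onLevel? s)

  -- The ordered pairs fall into four blocks, and the two mixed blocks together form
  -- `crossingsBetween`.
  crossings-split : ∀ s P →
    crossings P ≡ crossings (row s P) + crossingsBetween (row s P) (rest s P) + crossings (rest s P)
  crossings-split s P = begin
    crossings P                                    ≡⟨ ∑-split (onLevel? s) P ⟩
    (∑[ c ← D ] ∑[ d ← P ] X c d) + (∑[ c ← R ] ∑[ d ← P ] X c d)
      ≡⟨ cong₂ _+_ (splitʳ D) (splitʳ R) ⟩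
    (crossings D + ∑[ c ← D ] ∑[ d ← R ] X c d) + ((∑[ c ← R ] ∑[ d ← D ] X c d) + crossings R)
      ≡⟨ cong (λ z → crossings D + ∑[ c ← D ] ∑[ d ← R ] X c d + (z + crossings R)) (∑-swap R D) ⟩
    (crossings D + ∑[ c ← D ] ∑[ d ← R ] X c d) + ((∑[ c ← D ] ∑[ d ← R ] X d c) + crossings R)
      ≡⟨ regroup (crossings D) _ _ (crossings R) ⟩
    crossings D + ((∑[ c ← D ] ∑[ d ← R ] X c d) + (∑[ c ← D ] ∑[ d ← R ] X d c)) + crossings R
      ≡⟨ cong (λ z → crossings D + z + crossings R) (∑-+ D _ _) ⟨
    crossings D + (∑[ c ← D ] (∑[ d ← R ] X c d + ∑[ d ← R ] X d c)) + crossings R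
      ≡⟨ cong (λ z → crossings D + z + crossings R) (∑-cong D λ c → ∑-+ R (X c) (λ d → X d c)) ⟨
    crossings D + crossingsBetween D R + crossings R ∎
    where
    open ≡-Reasoning
    D = row s P
    R = rest s P
    X : Cell → Cell → ℕ
    X c d = ⟦ crosses? c d ⟧
    splitʳ : ∀ Q → ∑[ c ← Q ] ∑[ d ← P ] X c d ≡
             (∑[ c ← Q ] ∑[ d ← D ] X c d) + (∑[ c ← Q ] ∑[ d ← R ] X c d)
    splitʳ Q = trans (∑-cong Q λ c → ∑-split (onLevel? s) P) (∑-+ Q _ _)
    regroup : ∀ a b c d → (a + b) + (c + d) ≡ a + (b + c) + d
    regroup = solve-∀

  crossingsBetween-row : ∀ t P Q →
    crossingsBetween P Q ≡ crossingsBetween P (row t Q) + crossingsBetween P (rest t Q)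
  crossingsBetween-row t P Q = trans (∑-cong P λ c → ∑-split (onLevel? t) Q) (∑-+ P _ _)

  pairs≤crossings : ∀ {D} → Unique D →
    (∀ {c d} → c ∈ D → d ∈ D → c ≢ d → Crosses c d ⊎ Crosses d c) → pairs (length D) ≤ crossings D
  pairs≤crossings [] _ = z≤n
  pairs≤crossings {c ∷ D} (c∉ ∷ u) cross = begin
    length D + pairs (length D)
      ≤⟨ +-mono-≤ c×D (pairs≤crossings u (λ x y → cross (there x) (there y))) ⟩
    ∑[ d ← D ] (X c d + X d c) + crossings D
      ≡⟨ cong (_+ crossings D) (∑-+ D (X c) (λ d → X d c)) ⟩
    ∑[ d ← D ] X c d + ∑[ d ← D ] X d c + crossings D             ≤⟨ m≤n+m _ (X c c) ⟩
    X c c + (∑[ d ← D ] X c d + ∑[ d ← D ] X d c + crossings D)   ≡⟨ regroup (X c c) _ _ (crossings D) ⟩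
    X c c + ∑[ d ← D ] X c d + (∑[ d ← D ] X d c + crossings D)
      ≡⟨ cong (X c c + ∑[ d ← D ] X c d +_) (∑-+ D _ _) ⟨
    crossings (c ∷ D)                                             ∎
    where
    open ≤-Reasoning
    X : Cell → Cell → ℕ
    X c d = ⟦ crosses? c d ⟧
    regroup : ∀ a b c d → a + (b + c + d) ≡ a + b + (c + d)
    regroup = solve-∀
    once : ∀ {d} → d ∈ D → 1 ≤ X c d + X d c
    once {d} d∈ = 1≤⟦⟧+⟦⟧ (crosses? c d) (crosses? d c)
      (cross (here refl) (there d∈) (All.lookup c∉ d∈))
    c×D : length D ≤ ∑[ d ← D ] (X c d + X d c)
    c×D = ≤-trans (≤-reflexive (length≡∑1 D)) (∑-mono D once)

  ∈-row⁻ : ∀ {s P c} → c ∈ row s P → level c ≡ s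
  ∈-row⁻ {s} {P} c∈ = proj₂ (∈-filter⁻ (onLevel? s) {xs = P} c∈)

  -- If `d` has the smaller first coordinate, its level being no lower forces a larger second
  -- coordinate. If its first coordinate is larger by more than `t`, the `t` additional levels
  -- cannot compensate, and its second coordinate is smaller.
  Far⇒crosses : ∀ t {c d} → level d ≡ level c + t → Far t (proj₁ c) (proj₁ d) → Crosses c d ⊎ Crosses d c
  Far⇒crosses t {i , j} {i′ , j′} eq (inj₁ i′<i) = inj₂ (i′<i , +-cancelˡ-< i′ j j′ (begin-strict
    i′ + j     <⟨ +-monoˡ-< j i′<i ⟩
    i + j      ≤⟨ m≤m+n (i + j) t ⟩
    i + j + t  ≡⟨ eq ⟨
    i′ + j′    ∎))
    where open ≤-Reasoning
  Far⇒crosses t {i , j} {i′ , j′} eq (inj₂ i+t<i′) = inj₁ (≤-<-trans (m≤m+n i t) i+t<i′ ,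
    +-cancelˡ-< (i + t) j′ j (begin-strict
      i + t + j′   <⟨ +-monoˡ-< j′ i+t<i′ ⟩
      i′ + j′      ≡⟨ eq ⟩
      i + j + t    ≡⟨ +-CS.xy∙z≈xz∙y i j t ⟩
      i + t + j    ∎))
    where open ≤-Reasoning

  -- Within a level the first coordinate determines the second. This is why `Unique-map⁺` asks for
  -- injectivity on the list only.
  row-proj₁-injective : ∀ s P {c d} → c ∈ row s P → d ∈ row s P → proj₁ c ≡ proj₁ d → c ≡ d
  row-proj₁-injective s P {i , j} c∈ d∈ refl =
    cong (i ,_) (+-cancelˡ-≡ i _ _ (trans (∈-row⁻ {P = P} c∈) (sym (∈-row⁻ {P = P} d∈))))

  -- For t = 0, `Far` just says that the first coordinates differ, so any two cells of one level
  -- cross.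
  row-crossings : ∀ s {P} → Unique P → pairs (length (row s P)) ≤ crossings (row s P)
  row-crossings s {P} u = pairs≤crossings (Unique.filter⁺ (onLevel? s) u) λ {c} {d} c∈ d∈ c≢d →
    Far⇒crosses 0 (trans (∈-row⁻ {P = P} d∈) (trans (sym (∈-row⁻ {P = P} c∈)) (sym (+-identityʳ _))))
      (far c∈ d∈ c≢d (<-cmp (proj₁ c) (proj₁ d)))
    where
    far : ∀ {c d} → c ∈ row s P → d ∈ row s P → c ≢ d →
          Tri (proj₁ c < proj₁ d) (proj₁ c ≡ proj₁ d) (proj₁ d < proj₁ c) → Far 0 (proj₁ c) (proj₁ d)
    far {c} {d} c∈ d∈ c≢d (tri< i<i′ _ _) = inj₂ (subst (_< proj₁ d) (sym (+-identityʳ (proj₁ c))) i<i′)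
    far c∈ d∈ c≢d (tri≈ _ i≡i′ _) = contradiction (row-proj₁-injective s P c∈ d∈ i≡i′) c≢d
    far c∈ d∈ c≢d (tri> _ _ i′<i) = inj₁ i′<i

  rows-crossings : ∀ {s s′} t {P Q} → s′ ≡ s + t → Unique P → Unique Q →
    farBound t (length (row s P)) (length (row s′ Q)) ≤ crossingsBetween (row s P) (row s′ Q)
  rows-crossings {s} {s′} t {P} {Q} s′≡ uP uQ = begin
    farBound t (length D) (length E)
      ≡⟨ cong₂ (farBound t) (length-map proj₁ D) (length-map proj₁ E) ⟨
    farBound t (length (map proj₁ D)) (length (map proj₁ E))     ≤⟨ farBound≤ t (unique s P uP) (unique s′ Q uQ) ⟩
    ∑[ x ← map proj₁ D ] ∑[ y ← map proj₁ E ] ⟦ far? t x y ⟧      ≡⟨ ∑-map proj₁ D ⟩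
    ∑[ c ← D ] ∑[ y ← map proj₁ E ] ⟦ far? t (proj₁ c) y ⟧        ≡⟨ ∑-cong D (λ _ → ∑-map proj₁ E) ⟩
    ∑[ c ← D ] ∑[ d ← E ] ⟦ far? t (proj₁ c) (proj₁ d) ⟧          ≤⟨ ∑-mono D (λ c∈ → ∑-mono E (λ d∈ → crossed c∈ d∈)) ⟩
    crossingsBetween D E                                         ∎
    where
    open ≤-Reasoning
    D = row s P
    E = row s′ Q
    unique : ∀ s P → Unique P → Unique (map proj₁ (row s P))
    unique s P u = Unique-map⁺ proj₁ (row-proj₁-injective s P) (Unique.filter⁺ (onLevel? s) u)
    crossed : ∀ {c d} → c ∈ D → d ∈ E → ⟦ far? t (proj₁ c) (proj₁ d) ⟧ ≤ ⟦ crosses? c d ⟧ + ⟦ crosses? d c ⟧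
    crossed {c} {d} c∈ d∈ = ⟦⟧≤ (far? t (proj₁ c) (proj₁ d)) λ far →
      1≤⟦⟧+⟦⟧ (crosses? c d) (crosses? d c)
        (Far⇒crosses t (trans (∈-row⁻ {P = Q} d∈) (trans s′≡ (cong (_+ t) (sym (∈-row⁻ {P = P} c∈))))) far)

  -- Summation over the levels.

  #row : ℕ → List Cell → ℕ
  #row s P = length (row s P)

  row-rest : ∀ s t P → t ≢ s → row t (rest s P) ≡ row t P
  row-rest s t P t≢s = filter-¬-absorb (onLevel? t) (onLevel? s) (λ eq eq′ → t≢s (trans (sym eq) eq′)) P

  -- Induction on the number `k` of levels from `s` on. By `stepBound`, peeling off level s replaces
  -- the potential of levels s and s + 1 by that of s + 1 and s + 2 at a charge of 10. The negative
  -- term of the potential stands on the right. The `2` completes the `3` that `cells-bound`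
  -- cancels.
  levels-bound : ∀ k s {P} → Unique P → (∀ {c} → c ∈ P → s ≤ level c × level c < s + k) →
    6 * length P + (10 ∸ (cap (#row s P) + cap (#row (suc s) P))) ≤
    crossings P + 10 * suc k + cap (#row s P) + 2
  -- With no level left, the potential of two empty levels is 10; this accounts for `suc k` tens for
  -- `k` levels.
  levels-bound zero s {[]}    u within = m≤m+n 10 2
  levels-bound zero s {c ∷ P} u within = contradiction (proj₂ (within (here refl)))
    (≤⇒≯ (subst (_≤ level c) (sym (+-identityʳ s)) (proj₁ (within (here refl)))))
  levels-bound (suc k) s {P} u within = subst
    (λ m → 6 * m + (10 ∸ (cap a + cap b)) ≤ crossings P + 10 * suc (suc k) + cap a + 2)
    (sym size)
    (arith a (length R) (10 ∸ (cap a + cap b)) (cap a) (cap b) (10 ∸ (cap b + cap c)) (crossings R) k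
      (stepBound a b c) (rows-of-rest (levels-bound k (suc s) uR within′)) peeled)
    where
    open ≤-Reasoning
    D = row s P
    R = rest s P
    -- Level s + 2 is taken from `R₁`, where level s + 1 is already removed, so that both
    -- contributions are disjoint parts of `crossingsBetween D R`.
    R₁ = rest (suc s) R
    a = #row s P
    b = #row (suc s) P
    c = #row (suc (suc s)) P
    uR : Unique R
    uR = Unique.filter⁺ (¬? ∘ onLevel? s) u
    uR₁ : Unique R₁
    uR₁ = Unique.filter⁺ (¬? ∘ onLevel? (suc s)) uR
    b-rest : #row (suc s) R ≡ b
    b-rest = cong length (row-rest s (suc s) P 1+n≢n)
    c-rest : #row (suc (suc s)) R ≡ c
    c-rest = cong length (row-rest s (suc (suc s)) P (m+1+n≢n 1))
    c-rest₁ : #row (suc (suc s)) R₁ ≡ c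
    c-rest₁ = trans (cong length (row-rest (suc s) (suc (suc s)) R 1+n≢n)) c-rest
    near₁ : farBound 1 a b ≤ crossingsBetween D (row (suc s) R)
    near₁ = subst (λ n → farBound 1 a n ≤ crossingsBetween D (row (suc s) R)) b-rest
      (rows-crossings 1 (+-comm 1 s) u uR)
    near₂ : farBound 2 a c ≤ crossingsBetween D (row (suc (suc s)) R₁)
    near₂ = subst (λ n → farBound 2 a n ≤ crossingsBetween D (row (suc (suc s)) R₁)) c-rest₁
      (rows-crossings 2 (+-comm 2 s) u uR₁)
    between : crossingsBetween D (row (suc s) R) + crossingsBetween D (row (suc (suc s)) R₁) ≤
              crossingsBetween D R
    between = begin
      crossingsBetween D (row (suc s) R) + crossingsBetween D (row (suc (suc s)) R₁)
        ≤⟨ +-monoʳ-≤ (crossingsBetween D (row (suc s) R))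
             (m≤m+n _ (crossingsBetween D (rest (suc (suc s)) R₁))) ⟩
      crossingsBetween D (row (suc s) R) +
        (crossingsBetween D (row (suc (suc s)) R₁) + crossingsBetween D (rest (suc (suc s)) R₁))
        ≡⟨ cong (crossingsBetween D (row (suc s) R) +_) (crossingsBetween-row (suc (suc s)) D R₁) ⟨
      crossingsBetween D (row (suc s) R) + crossingsBetween D R₁
        ≡⟨ crossingsBetween-row (suc s) D R ⟨
      crossingsBetween D R ∎
    peeled : pairs a + farBound 1 a b + farBound 2 a c + crossings R ≤ crossings P
    peeled = begin
      pairs a + farBound 1 a b + farBound 2 a c + crossings R
        ≤⟨ +-monoˡ-≤ (crossings R) (+-mono-≤ (+-mono-≤ (row-crossings s u) near₁) near₂) ⟩
      crossings D + crossingsBetween D (row (suc s) R) + crossingsBetween D (row (suc (suc s)) R₁) + crossings R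
        ≤⟨ +-monoˡ-≤ (crossings R) (≤-trans (≤-reflexive (+-assoc (crossings D) _ _))
             (+-monoʳ-≤ (crossings D) between)) ⟩
      crossings D + crossingsBetween D R + crossings R
        ≡⟨ crossings-split s P ⟨
      crossings P ∎
    rows-of-rest : 6 * length R + (10 ∸ (cap (#row (suc s) R) + cap (#row (suc (suc s)) R))) ≤
                    crossings R + 10 * suc k + cap (#row (suc s) R) + 2 →
                    6 * length R + (10 ∸ (cap b + cap c)) ≤ crossings R + 10 * suc k + cap b + 2
    rows-of-rest = subst₂
      (λ x y → 6 * length R + (10 ∸ (cap x + cap y)) ≤ crossings R + 10 * suc k + cap x + 2)
      b-rest c-rest
    within′ : ∀ {c} → c ∈ R → suc s ≤ level c × level c < suc s + k
    within′ {c} c∈ with ∈-filter⁻ (¬? ∘ onLevel? s) {xs = P} c∈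
    ... | c∈P , c≢s = ≤∧≢⇒< (proj₁ (within c∈P)) (c≢s ∘ sym) ,
                      subst (level c <_) (+-suc s k) (proj₂ (within c∈P))
    size : length P ≡ a + length R
    size = trans (length-split (onLevel? s) P) (cong (_+ length R) (sym (length-filter-∑ (onLevel? s) P)))
    arith : ∀ a r u â b̂ v χR k {p χ} → 6 * a + u + b̂ ≤ p + 10 + â + v →
            6 * r + v ≤ χR + 10 * suc k + b̂ + 2 →
            p + χR ≤ χ → 6 * (a + r) + u ≤ χ + 10 * suc (suc k) + â + 2
    -- Telescoping: `step` and `ih` carry the potential of the next two levels on opposite sides, so
    -- `b̂ + v` occurs on both sides of their sum.
    arith a r u â b̂ v χR k {p} {χ} step ih peel = +-cancelʳ-≤ (b̂ + v) _ _ (begin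
      6 * (a + r) + u + (b̂ + v)                              ≡⟨ e₁ a r u b̂ v ⟩
      (6 * a + u + b̂) + (6 * r + v)                          ≤⟨ +-mono-≤ step ih ⟩
      (p + 10 + â + v) + (χR + 10 * suc k + b̂ + 2)           ≡⟨ e₂ p â v χR k b̂ ⟩
      (p + χR) + (10 * suc (suc k) + â + 2 + (b̂ + v))        ≤⟨ +-monoˡ-≤ _ peel ⟩
      χ + (10 * suc (suc k) + â + 2 + (b̂ + v))               ≡⟨ e₃ χ k â b̂ v ⟩
      χ + 10 * suc (suc k) + â + 2 + (b̂ + v)                 ∎)
      where
      e₁ : ∀ a r u b v → 6 * (a + r) + u + (b + v) ≡ (6 * a + u + b) + (6 * r + v)
      e₁ = solve-∀
      e₂ : ∀ p a v χ k b → (p + 10 + a + v) + (χ + 10 * suc k + b + 2) ≡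
           (p + χ) + (10 * suc (suc k) + a + 2 + (b + v))
      e₂ = solve-∀
      e₃ : ∀ χ k a b v → χ + (10 * suc (suc k) + a + 2 + (b + v)) ≡ χ + 10 * suc (suc k) + a + 2 + (b + v)
      e₃ = solve-∀

  #row₀≤1 : ∀ {P} → Unique P → #row 0 P ≤ 1
  #row₀≤1 {P} u = subst (_≤ 1) (length-map proj₁ (row 0 P))
    (length≤width 0 1 (Unique-map⁺ proj₁ (row-proj₁-injective 0 P) (Unique.filter⁺ (onLevel? 0) u)) zeros)
    where
    zeros : ∀ {x} → x ∈ map proj₁ (row 0 P) → 0 ≤ x × x < 1
    zeros x∈ with ∈-map⁻ proj₁ x∈
    ... | (i , j) , c∈ , refl = z≤n , s≤s (≤-trans (m≤m+n i j) (≤-reflexive (∈-row⁻ {P = P} c∈)))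

  -- The cells occupy at most k - 1 levels, each charged 10; the remaining 10 is the potential after
  -- the last level.
  cells-bound : ∀ k {P} → Unique P → (∀ {c} → c ∈ P → 2 + level c ≤ k) → 6 * length P ≤ crossings P + 10 * k
  cells-bound k {[]}     u within = z≤n
  cells-bound zero {c ∷ P} u within = contradiction (within (here refl)) λ ()
  cells-bound (suc k) {P@(_ ∷ _)} u within = +-cancelʳ-≤ 3 _ _ (begin
    -- Level 0 contains at most the cell (0 , 0) and level 1 is capped at 6, so the initial
    -- potential supplies 10 - (1 + 6) = 3, which matches 1 + 2 on the right.
    6 * length P + 3                                                   ≤⟨ +-monoʳ-≤ (6 * length P) 3≤ ⟩
    6 * length P + (10 ∸ (cap (#row 0 P) + cap (#row 1 P)))
      ≤⟨ levels-bound k 0 u (λ c∈ → z≤n , s≤s⁻¹ (within c∈)) ⟩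
    crossings P + 10 * suc k + cap (#row 0 P) + 2                      ≡⟨ +-assoc (crossings P + 10 * suc k) _ 2 ⟩
    crossings P + 10 * suc k + (cap (#row 0 P) + 2)
      ≤⟨ +-monoʳ-≤ (crossings P + 10 * suc k) (+-monoˡ-≤ 2 cap≤1) ⟩
    crossings P + 10 * suc k + 3                                       ∎)
    where
    open ≤-Reasoning
    cap≤1 : cap (#row 0 P) ≤ 1
    cap≤1 = ≤-trans (m⊓n≤m (#row 0 P) 6) (#row₀≤1 u)
    3≤ : 3 ≤ 10 ∸ (cap (#row 0 P) + cap (#row 1 P))
    3≤ = ∸-monoʳ-≤ 10 (+-mono-≤ cap≤1 (m⊓n≤n (#row 1 P) 6))

  -- Random subsets

  Subset : ℕ → Set
  Subset n = Fin n → Bool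

  ⟦_∋_⟧ : Subset n → Fin n → ℕ
  ⟦ σ ∋ x ⟧ = ⟦ T? (σ x) ⟧

  -- A product of indicators, so that `𝔼-∋` can split off one vertex at a time.
  ⟦_⊇_⟧ : Subset n → List (Fin n) → ℕ
  ⟦ σ ⊇ [] ⟧     = 1
  ⟦ σ ⊇ x ∷ xs ⟧ = ⟦ σ ∋ x ⟧ * ⟦ σ ⊇ xs ⟧

  IgnoresAt : Fin n → (Subset n → ℕ) → Set
  IgnoresAt x G = ∀ σ τ → (∀ y → y ≢ x → σ y ≡ τ y) → G σ ≡ G τ

  module Sampling (p q : ℕ) where

    -- (p + q) ^ n times the expectation over the random subset of Fin n that
    -- contains each vertex independently with probability p / (p + q).
    𝔼 : ∀ n → (Subset n → ℕ) → ℕ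
    𝔼 zero    F = F Vec.[]
    𝔼 (suc n) F = p * 𝔼 n (F ∘ (true Vec.∷_)) + q * 𝔼 n (F ∘ (false Vec.∷_))

    𝔼-mono : ∀ n {F G} → (∀ σ → F σ ≤ G σ) → 𝔼 n F ≤ 𝔼 n G
    𝔼-mono zero    F≤G = F≤G _
    𝔼-mono (suc n) F≤G = +-mono-≤ (*-monoʳ-≤ p (𝔼-mono n (λ σ → F≤G _)))
                                  (*-monoʳ-≤ q (𝔼-mono n (λ σ → F≤G _)))

    𝔼-cong : ∀ n {F G} → (∀ σ → F σ ≡ G σ) → 𝔼 n F ≡ 𝔼 n G
    𝔼-cong n F≡G = ≤-antisym (𝔼-mono n (≤-reflexive ∘ F≡G)) (𝔼-mono n (≤-reflexive ∘ sym ∘ F≡G))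

    𝔼-+ : ∀ n F G → 𝔼 n (λ σ → F σ + G σ) ≡ 𝔼 n F + 𝔼 n G
    𝔼-+ zero    F G = refl
    𝔼-+ (suc n) F G = trans (cong₂ (λ x y → p * x + q * y) (𝔼-+ n _ _) (𝔼-+ n _ _)) (distribute p q _ _ _ _)
      where
      distribute : ∀ p q a b c d → p * (a + b) + q * (c + d) ≡ (p * a + q * c) + (p * b + q * d)
      distribute = solve-∀

    𝔼-* : ∀ n k F → 𝔼 n (λ σ → k * F σ) ≡ k * 𝔼 n F
    𝔼-* zero    k F = refl
    𝔼-* (suc n) k F = trans (cong₂ (λ x y → p * x + q * y) (𝔼-* n k _) (𝔼-* n k _)) (distribute p q k _ _)
      where
      distribute : ∀ p q k a b → p * (k * a) + q * (k * b) ≡ k * (p * a + q * b)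
      distribute = solve-∀

    𝔼-0 : ∀ n → 𝔼 n (λ _ → 0) ≡ 0
    𝔼-0 n = 𝔼-* n 0 (λ _ → 0)

    𝔼-∑ : ∀ n (xs : List A) (F : A → Subset n → ℕ) →
          𝔼 n (λ σ → ∑[ x ← xs ] F x σ) ≡ ∑[ x ← xs ] 𝔼 n (F x)
    𝔼-∑ n []       F = 𝔼-0 n
    𝔼-∑ n (x ∷ xs) F = trans (𝔼-+ n (F x) _) (cong (𝔼 n (F x) +_) (𝔼-∑ n xs F))

    -- Independence of `G` from the choice at `x`, with the denominator p + q multiplied out. At
    -- vertex `zero` only the branch that chooses it survives, and `ignores` identifies the two
    -- branches of `G`.
    𝔼-∋ : ∀ n x G → IgnoresAt x G → (p + q) * 𝔼 n (λ σ → ⟦ σ ∋ x ⟧ * G σ) ≡ p * 𝔼 n G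
    𝔼-∋ (suc n) zero G ignores = begin
      (p + q) * (p * 𝔼 n (λ σ → 1 * G (true Vec.∷ σ)) + q * 𝔼 n (λ _ → 0))
        ≡⟨ cong₂ (λ x y → (p + q) * (p * x + q * y)) (𝔼-cong n (λ σ → *-identityˡ _)) (𝔼-0 n) ⟩
      (p + q) * (p * 𝔼 n (G ∘ (true Vec.∷_)) + q * 0)
        ≡⟨ regroup p q _ ⟩
      p * (p * 𝔼 n (G ∘ (true Vec.∷_)) + q * 𝔼 n (G ∘ (true Vec.∷_)))
        ≡⟨ cong (λ z → p * (p * 𝔼 n (G ∘ (true Vec.∷_)) + q * z))
             (𝔼-cong n λ σ → ignores (true Vec.∷ σ) (false Vec.∷ σ) λ { zero y≢x → contradiction refl y≢x ; (suc y) _ → refl }) ⟩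
      p * (p * 𝔼 n (G ∘ (true Vec.∷_)) + q * 𝔼 n (G ∘ (false Vec.∷_)))
        ∎
      where
      open ≡-Reasoning
      regroup : ∀ p q x → (p + q) * (p * x + q * 0) ≡ p * (p * x + q * x)
      regroup = solve-∀
    𝔼-∋ (suc n) (suc x) G ignores = trans
      (distribute p q _ _)
      (trans (cong₂ (λ x y → p * x + q * y) (𝔼-∋ n x _ (tail true)) (𝔼-∋ n x _ (tail false)))
             (factor p q _ _))
      where
      tail : ∀ b → IgnoresAt x (λ σ → G (b Vec.∷ σ))
      tail b σ τ σ≡τ = ignores (b Vec.∷ σ) (b Vec.∷ τ)
        λ { zero _ → refl ; (suc y) y≢x → σ≡τ y (y≢x ∘ cong suc) }
      distribute : ∀ p q a b → (p + q) * (p * a + q * b) ≡ p * ((p + q) * a) + q * ((p + q) * b)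
      distribute = solve-∀
      factor : ∀ p q a b → p * (p * a) + q * (p * b) ≡ p * (p * a + q * b)
      factor = solve-∀

    𝔼-const : ∀ n k → 𝔼 n (λ _ → k) ≡ k * (p + q) ^ n
    𝔼-const zero    k = sym (*-identityʳ k)
    𝔼-const (suc n) k = trans (cong (λ z → p * z + q * z) (𝔼-const n k)) (factor p q k _)
      where
      factor : ∀ p q k x → p * (k * x) + q * (k * x) ≡ k * ((p + q) * x)
      factor = solve-∀

    -- Distinct vertices are chosen independently, each with probability p / (p + q). The last
    -- factor is the scale of `𝔼`.
    𝔼-⊇ : ∀ {n} {xs : List (Fin n)} → Unique xs →
          (p + q) ^ length xs * 𝔼 n ⟦_⊇ xs ⟧ ≡ p ^ length xs * (p + q) ^ n
    𝔼-⊇ {n} [] = trans (*-identityˡ _) (𝔼-const n 1)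
    𝔼-⊇ {n} {x ∷ xs} (x∉ ∷ u) = begin
      (p + q) * (p + q) ^ length xs * 𝔼 n ⟦_⊇ x ∷ xs ⟧     ≡⟨ *-CS.xy∙z≈y∙xz (p + q) _ _ ⟩
      (p + q) ^ length xs * ((p + q) * 𝔼 n ⟦_⊇ x ∷ xs ⟧)   ≡⟨ cong ((p + q) ^ length xs *_) (𝔼-∋ n x ⟦_⊇ xs ⟧ (ignores x∉)) ⟩
      (p + q) ^ length xs * (p * 𝔼 n ⟦_⊇ xs ⟧)             ≡⟨ *-CS.x∙yz≈y∙xz ((p + q) ^ length xs) p _ ⟩
      p * ((p + q) ^ length xs * 𝔼 n ⟦_⊇ xs ⟧)             ≡⟨ cong (p *_) (𝔼-⊇ u) ⟩
      p * (p ^ length xs * (p + q) ^ n)                    ≡⟨ *-assoc p _ _ ⟨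
      p ^ length (x ∷ xs) * (p + q) ^ n                    ∎
      where
      open ≡-Reasoning
      ignores : ∀ {ys} → All (x ≢_) ys → IgnoresAt x ⟦_⊇ ys ⟧
      ignores []           σ τ σ≡τ = refl
      ignores (x≢y ∷ x∉ys) σ τ σ≡τ =
        cong₂ _*_ (cong (λ b → ⟦ T? b ⟧) (σ≡τ _ (x≢y ∘ sym))) (ignores x∉ys σ τ σ≡τ)

  ⟦⟧-disjoint : ∀ {R : Set} (P? : Dec P) (Q? : Dec Q) (R? : Dec R) →
                (P → R) → (Q → R) → (P → ¬ Q) → ⟦ P? ⟧ + ⟦ Q? ⟧ ≤ ⟦ R? ⟧
  ⟦⟧-disjoint (no _)  Q?      R? P⇒R Q⇒R P⇒¬Q = ⟦⟧-mono Q? R? Q⇒R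
  ⟦⟧-disjoint (yes p) (no _)  R? P⇒R Q⇒R P⇒¬Q = 1≤⟦⟧ R? (P⇒R p)
  ⟦⟧-disjoint (yes p) (yes q) R? P⇒R Q⇒R P⇒¬Q = contradiction q (P⇒¬Q p)

  ⟦⟧-× : (P? : Dec P) (Q? : Dec Q) → ⟦ P? ×-dec Q? ⟧ ≡ ⟦ P? ⟧ * ⟦ Q? ⟧
  ⟦⟧-× (yes _) Q? = sym (+-identityʳ _)
  ⟦⟧-× (no _)  Q? = refl

  -- Drawings

  module _ {n : ℕ} {G : Graph n} (𝒟 : Drawing G) where
    open Graph G
    open Drawing 𝒟 renaming (crossings to drawnCrossings)

    -- `edges` orients an edge by index, `uvEdges` by layer, so an edge with i < j appears in
    -- `uvEdges` as (i , j) or (j , i). Exchanging i and j in the second sum leaves the mutually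
    -- exclusive tests i < j and j < i on the same pair.
    size≤uvEdges : size ≤ length uvEdges
    size≤uvEdges = begin
      size
        ≡⟨ trans (length-filter-∑ _ (cartesianProduct V* V*)) (∑-cartesianProduct V* V*) ⟩
      ∑[ i ← V* ] ∑[ j ← V* ] ⟦ (i Fin.<? j) ×-dec adj? i j ⟧
        ≤⟨ ∑-mono V* (λ {i} _ → ∑-mono V* (λ {j} _ → orient i j)) ⟩
      ∑[ i ← V* ] ∑[ j ← V* ] (⟦ (i Fin.<? j) ×-dec uvEdge? (i , j) ⟧ + ⟦ (i Fin.<? j) ×-dec uvEdge? (j , i) ⟧)
        ≡⟨ trans (∑-cong V* λ _ → ∑-+ V* _ _) (∑-+ V* _ _) ⟩
      (∑[ i ← V* ] ∑[ j ← V* ] ⟦ (i Fin.<? j) ×-dec uvEdge? (i , j) ⟧) +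
      (∑[ i ← V* ] ∑[ j ← V* ] ⟦ (i Fin.<? j) ×-dec uvEdge? (j , i) ⟧)
        ≡⟨ cong ((∑[ i ← V* ] ∑[ j ← V* ] ⟦ (i Fin.<? j) ×-dec uvEdge? (i , j) ⟧) +_) (∑-swap V* V*) ⟩
      (∑[ i ← V* ] ∑[ j ← V* ] ⟦ (i Fin.<? j) ×-dec uvEdge? (i , j) ⟧) +
      (∑[ i ← V* ] ∑[ j ← V* ] ⟦ (j Fin.<? i) ×-dec uvEdge? (i , j) ⟧)
        ≡⟨ trans (∑-cong V* λ _ → ∑-+ V* _ _) (∑-+ V* _ _) ⟨
      ∑[ i ← V* ] ∑[ j ← V* ] (⟦ (i Fin.<? j) ×-dec uvEdge? (i , j) ⟧ + ⟦ (j Fin.<? i) ×-dec uvEdge? (i , j) ⟧)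
        ≤⟨ ∑-mono V* (λ {i} _ → ∑-mono V* (λ {j} _ → ⟦⟧-disjoint
             ((i Fin.<? j) ×-dec uvEdge? (i , j)) ((j Fin.<? i) ×-dec uvEdge? (i , j)) (uvEdge? (i , j))
             proj₂ proj₂ (λ (i<j , _) (j<i , _) → <-asym i<j j<i))) ⟩
      ∑[ i ← V* ] ∑[ j ← V* ] ⟦ uvEdge? (i , j) ⟧
        ≡⟨ trans (length-filter-∑ uvEdge? (cartesianProduct V* V*)) (∑-cartesianProduct V* V*) ⟨
      length uvEdges ∎
      where
      open ≤-Reasoning
      V* = allFin n
      orient : ∀ i j → ⟦ (i Fin.<? j) ×-dec adj? i j ⟧ ≤
               ⟦ (i Fin.<? j) ×-dec uvEdge? (i , j) ⟧ + ⟦ (i Fin.<? j) ×-dec uvEdge? (j , i) ⟧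
      orient i j = ⟦⟧≤ ((i Fin.<? j) ×-dec adj? i j) λ (i<j , ij) →
        1≤⟦⟧+⟦⟧ ((i Fin.<? j) ×-dec uvEdge? (i , j)) ((i Fin.<? j) ×-dec uvEdge? (j , i))
          (by-layers i<j ij (layer i) (layer j) refl refl)
        where
        by-layers : i Fin.< j → Adj i j → ∀ k l → layer i ≡ k → layer j ≡ l →
          (i Fin.< j × UVEdge (i , j)) ⊎ (i Fin.< j × UVEdge (j , i))
        by-layers i<j ij U V i∈ j∈ = inj₁ (i<j , i∈ , j∈ , ij)
        by-layers i<j ij V U i∈ j∈ = inj₂ (i<j , j∈ , i∈ , adj-sym ij)
        by-layers i<j ij U U i∈ j∈ = contradiction (trans i∈ (sym j∈)) (proj₁ isDrawing i j ij)
        by-layers i<j ij V V i∈ j∈ = contradiction (trans i∈ (sym j∈)) (proj₁ isDrawing i j ij)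

    uvEdges-unique : Unique uvEdges
    uvEdges-unique = Unique.filter⁺ uvEdge? (Unique.cartesianProduct⁺ (Unique.allFin⁺ n) (Unique.allFin⁺ n))

    uvEdge-∈ : ∀ {e} → e ∈ uvEdges → UVEdge e
    uvEdge-∈ e∈ = proj₂ (∈-filter⁻ uvEdge? {xs = cartesianProduct (allFin n) (allFin n)} e∈)

    U≢V : ∀ {u v} → layer u ≡ U → layer v ≡ V → u ≢ v
    U≢V u∈ v∈ refl with trans (sym u∈) v∈
    ... | ()

    -- The subgraph induced by a chosen subset.

    module _ (σ : Subset n) where

      card : ℕ
      card = ∑[ x ← allFin n ] ⟦ σ ∋ x ⟧

      Precedes : Fin n → Fin n → Set
      Precedes w v = T (σ w) × layer w ≡ layer v × pos w Fin.< pos v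

      precedes? : ∀ w v → Dec (Precedes w v)
      precedes? w v = T? (σ w) ×-dec ((layer w ≟ᴸ layer v) ×-dec (pos w Fin.<? pos v))

      -- Ranks count chosen vertices only, which keeps all levels below card.
      rank : Fin n → ℕ
      rank v = ∑[ w ← allFin n ] ⟦ precedes? w v ⟧

      inLayer? : ∀ l → Decidable (λ w → T (σ w) × layer w ≡ l)
      inLayer? l w = T? (σ w) ×-dec (layer w ≟ᴸ l)

      layerCard : Layer → ℕ
      layerCard l = ∑[ w ← allFin n ] ⟦ inLayer? l w ⟧

      -- The indicator of `v` fits under that of `Q` beside that of `P`, and it adds at least 1 to
      -- the sum.
      strict : ∀ {v} {P Q : Fin n → Set} (P? : Decidable P) (Q? : Decidable Q) →
               (∀ {w} → P w → Q w) → ¬ P v → Q v → ∑[ w ← allFin n ] ⟦ P? w ⟧ < ∑[ w ← allFin n ] ⟦ Q? w ⟧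
      strict {v} P? Q? P⊆Q ¬Pv Qv = begin-strict
        ∑[ w ← allFin n ] ⟦ P? w ⟧                                        <⟨ m<m+n _ (≤-trans (1≤⟦⟧ (v Fin.≟ v) refl) (f≤∑ (λ w → ⟦ w Fin.≟ v ⟧) (∈-allFin v))) ⟩
        ∑[ w ← allFin n ] ⟦ P? w ⟧ + ∑[ w ← allFin n ] ⟦ w Fin.≟ v ⟧      ≡⟨ ∑-+ (allFin n) _ _ ⟨
        ∑[ w ← allFin n ] (⟦ P? w ⟧ + ⟦ w Fin.≟ v ⟧)
          ≤⟨ ∑-mono (allFin n) (λ {w} _ → ⟦⟧-disjoint (P? w) (w Fin.≟ v) (Q? w) P⊆Q (λ { refl → Qv }) (λ { p refl → ¬Pv p })) ⟩
        ∑[ w ← allFin n ] ⟦ Q? w ⟧                                        ∎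
        where open ≤-Reasoning

      rank-<⁺ : ∀ {w v} → Precedes w v → rank w < rank v
      rank-<⁺ {w} {v} w<v@(_ , lw≡lv , pw<pv) = strict (λ x → precedes? x w) (λ x → precedes? x v)
        (λ (x∈ , lx≡lw , px<pw) → x∈ , trans lx≡lw lw≡lv , <-trans px<pw pw<pv)
        (λ (_ , _ , pw<pw) → <-irrefl refl pw<pw) w<v

      -- Otherwise every vertex preceding `v` would precede `w`. This direction turns a crossing of
      -- cells into a crossing of the drawing.
      rank-<⁻ : ∀ {w v} → layer w ≡ layer v → rank w < rank v → pos w Fin.< pos v
      rank-<⁻ {w} {v} lw≡lv rw<rv = ≰⇒> λ pv≤pw → <⇒≱ rw<rv (∑-mono (allFin n) λ {x} _ →
        ⟦⟧-mono (precedes? x v) (precedes? x w)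
          λ (x∈ , lx≡lv , px<pv) → x∈ , trans lx≡lv (sym lw≡lv) , <-≤-trans px<pv pv≤pw)

      rank-injective : ∀ {w v} → T (σ w) → T (σ v) → layer w ≡ layer v → rank w ≡ rank v → w ≡ v
      rank-injective {w} {v} w∈ v∈ lw≡lv rw≡rv with Fin.<-cmp (pos w) (pos v)
      ... | tri< pw<pv _ _ = contradiction rw≡rv (<⇒≢ (rank-<⁺ (w∈ , lw≡lv , pw<pv)))
      ... | tri≈ _ pw≡pv _ = proj₂ isDrawing w v lw≡lv pw≡pv
      ... | tri> _ _ pv<pw = contradiction (sym rw≡rv) (<⇒≢ (rank-<⁺ (v∈ , sym lw≡lv , pv<pw)))

      rank<layerCard : ∀ {v l} → T (σ v) → layer v ≡ l → rank v < layerCard l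
      rank<layerCard {v} v∈ refl = strict (λ x → precedes? x v) (inLayer? (layer v))
        (λ (x∈ , lx≡lv , _) → x∈ , lx≡lv) (λ (_ , _ , pv<pv) → <-irrefl refl pv<pv) (v∈ , refl)

      layerCards : layerCard U + layerCard V ≤ card
      layerCards = ≤-trans (≤-reflexive (sym (∑-+ (allFin n) _ _))) (∑-mono (allFin n) λ {x} _ →
        ⟦⟧-disjoint (inLayer? U x) (inLayer? V x) (T? (σ x)) proj₁ proj₁
          (λ (_ , x∈U) (_ , x∈V) → U≢V x∈U x∈V refl))

      Chosen : Fin n × Fin n → Set
      Chosen (u , v) = T (σ u) × T (σ v)

      chosen? : Decidable Chosen
      chosen? (u , v) = T? (σ u) ×-dec T? (σ v)

      chosenEdges : List (Fin n × Fin n)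
      chosenEdges = filter chosen? uvEdges

      cell : Fin n × Fin n → Cell
      cell (u , v) = rank u , rank v

      ∈-chosenEdges : ∀ {e} → e ∈ chosenEdges → UVEdge e × Chosen e
      ∈-chosenEdges e∈ with ∈-filter⁻ chosen? {xs = uvEdges} e∈
      ... | e∈uv , chosen = uvEdge-∈ e∈uv , chosen

      cells-unique : Unique (map cell chosenEdges)
      cells-unique = Unique-map⁺ cell injective (Unique.filter⁺ chosen? uvEdges-unique)
        where
        injective : ∀ {e f} → e ∈ chosenEdges → f ∈ chosenEdges → cell e ≡ cell f → e ≡ f
        injective e∈ f∈ eq with ∈-chosenEdges e∈ | ∈-chosenEdges f∈
        ... | (u∈U , v∈V , _) , (u∈ , v∈) | (u′∈U , v′∈V , _) , (u′∈ , v′∈) = cong₂ _,_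
          (rank-injective u∈ u′∈ (trans u∈U (sym u′∈U)) (cong proj₁ eq))
          (rank-injective v∈ v′∈ (trans v∈V (sym v′∈V)) (cong proj₂ eq))

      -- Ranks start at 0, so each is less than the number of chosen vertices on its line; hence the
      -- 2.
      cells-level : ∀ {c} → c ∈ map cell chosenEdges → 2 + level c ≤ card
      cells-level c∈ with ∈-map⁻ cell c∈
      ... | (u , v) , e∈ , refl with ∈-chosenEdges e∈
      ...   | (u∈U , v∈V , _) , (u∈ , v∈) = begin
        2 + (rank u + rank v)          ≡⟨ cong suc (sym (+-suc (rank u) (rank v))) ⟩
        suc (rank u) + suc (rank v)    ≤⟨ +-mono-≤ (rank<layerCard u∈ u∈U) (rank<layerCard v∈ v∈V) ⟩
        layerCard U + layerCard V      ≤⟨ layerCards ⟩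
        card                           ∎
        where open ≤-Reasoning

      -- The choice enters as a factor, so the range of summation does not depend on `σ` and `𝔼` can
      -- be taken termwise.
      chosenCrossings : ℕ
      chosenCrossings =
        ∑[ e ← uvEdges ] ∑[ f ← uvEdges ] ⟦ chosen? e ⟧ * (⟦ chosen? f ⟧ * ⟦ cross? (e , f) ⟧)

      -- The bound 6m ≤ cr + 10n for the subgraph induced by `σ`: `cells-bound` applies to its
      -- cells, and cells cross only where their edges do.
      chosen-bound : 6 * (∑[ e ← uvEdges ] ⟦ chosen? e ⟧) ≤ chosenCrossings + 10 * card
      chosen-bound = begin
        6 * (∑[ e ← uvEdges ] ⟦ chosen? e ⟧)
          ≡⟨ cong (6 *_) (trans (length-map cell chosenEdges) (length-filter-∑ chosen? uvEdges)) ⟨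
        6 * length (map cell chosenEdges)
          ≤⟨ cells-bound card cells-unique cells-level ⟩
        crossings (map cell chosenEdges) + 10 * card
          ≡⟨ cong (_+ 10 * card)
               (trans (∑-map cell chosenEdges) (∑-cong chosenEdges λ _ → ∑-map cell chosenEdges)) ⟩
        ∑[ e ← chosenEdges ] ∑[ f ← chosenEdges ] ⟦ crosses? (cell e) (cell f) ⟧ + 10 * card
          ≤⟨ +-monoˡ-≤ (10 * card) (∑-mono chosenEdges λ e∈ → ∑-mono chosenEdges λ f∈ → drawn e∈ f∈) ⟩
        ∑[ e ← chosenEdges ] ∑[ f ← chosenEdges ] ⟦ cross? (e , f) ⟧ + 10 * card
          ≡⟨ cong (_+ 10 * card) (trans (∑-filter chosen? uvEdges) (∑-cong uvEdges λ e →
               trans (cong (⟦ chosen? e ⟧ *_) (∑-filter chosen? uvEdges)) (sym (∑-* ⟦ chosen? e ⟧ uvEdges)))) ⟩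
        chosenCrossings + 10 * card ∎
        where
        open ≤-Reasoning
        drawn : ∀ {e f} → e ∈ chosenEdges → f ∈ chosenEdges →
                ⟦ crosses? (cell e) (cell f) ⟧ ≤ ⟦ cross? (e , f) ⟧
        drawn {e} {f} e∈ f∈ with ∈-chosenEdges e∈ | ∈-chosenEdges f∈
        ... | (u∈U , v∈V , _) , _ | (u′∈U , v′∈V , _) , _ =
          ⟦⟧-mono (crosses? (cell e) (cell f)) (cross? (e , f)) λ (ru<ru′ , rv′<rv) →
            rank-<⁻ (trans u∈U (sym u′∈U)) ru<ru′ , rank-<⁻ (trans v′∈V (sym v∈V)) rv′<rv

    -- Expected numbers of vertices, edges and crossings.

    module _ (p q : ℕ) where
      open Sampling p q

      private
        d = p + q
        D = d ^ n

        𝔼-∑-* : ∀ {A : Set} k (xs : List A) (F : A → Subset n → ℕ) →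
                k * 𝔼 n (λ σ → ∑[ x ← xs ] F x σ) ≡ ∑[ x ← xs ] k * 𝔼 n (F x)
        𝔼-∑-* k xs F = trans (cong (k *_) (𝔼-∑ n xs F)) (sym (∑-* k xs))

      𝔼-card : d * 𝔼 n card ≡ n * (p * D)
      𝔼-card = begin
        d * 𝔼 n card                                  ≡⟨ 𝔼-∑-* d (allFin n) (λ x σ → ⟦ σ ∋ x ⟧) ⟩
        ∑[ x ← allFin n ] d * 𝔼 n ⟦_∋ x ⟧             ≡⟨ ∑-cong (allFin n) one ⟩
        ∑[ _ ← allFin n ] p * D                       ≡⟨ ∑-const (allFin n) (p * D) ⟩
        length (allFin n) * (p * D)                   ≡⟨ cong (_* (p * D)) (length-tabulate {n = n} id) ⟩
        n * (p * D)                                   ∎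
        where
        open ≡-Reasoning
        one : ∀ x → d * 𝔼 n ⟦_∋ x ⟧ ≡ p * D
        one x = begin
          d * 𝔼 n ⟦_∋ x ⟧                ≡⟨ cong₂ _*_ (*-identityʳ d) (𝔼-cong n λ σ → *-identityʳ ⟦ σ ∋ x ⟧) ⟨
          d ^ 1 * 𝔼 n ⟦_⊇ x ∷ [] ⟧       ≡⟨ 𝔼-⊇ {xs = x ∷ []} ([] ∷ []) ⟩
          p ^ 1 * D                      ≡⟨ cong (_* D) (*-identityʳ p) ⟩
          p * D                          ∎

      𝔼-edges : length uvEdges * (p ^ 2 * D) ≤ d ^ 2 * 𝔼 n (λ σ → ∑[ e ← uvEdges ] ⟦ chosen? σ e ⟧)
      𝔼-edges = begin
        length uvEdges * (p ^ 2 * D)                                ≡⟨ ∑-const uvEdges (p ^ 2 * D) ⟨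
        ∑[ _ ← uvEdges ] p ^ 2 * D                                  ≤⟨ ∑-mono uvEdges one ⟩
        ∑[ e ← uvEdges ] d ^ 2 * 𝔼 n (λ σ → ⟦ chosen? σ e ⟧)        ≡⟨ 𝔼-∑-* (d ^ 2) uvEdges (λ e σ → ⟦ chosen? σ e ⟧) ⟨
        d ^ 2 * 𝔼 n (λ σ → ∑[ e ← uvEdges ] ⟦ chosen? σ e ⟧)        ∎
        where
        open ≤-Reasoning
        one : ∀ {e} → e ∈ uvEdges → p ^ 2 * D ≤ d ^ 2 * 𝔼 n (λ σ → ⟦ chosen? σ e ⟧)
        one {u , v} e∈ with uvEdge-∈ e∈
        ... | u∈U , v∈V , _ = ≤-reflexive (sym (trans
          (cong (d ^ 2 *_) (𝔼-cong n λ σ → trans (⟦⟧-× (T? (σ u)) (T? (σ v)))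
            (cong (⟦ σ ∋ u ⟧ *_) (sym (*-identityʳ ⟦ σ ∋ v ⟧)))))
          (𝔼-⊇ {xs = u ∷ v ∷ []} ((U≢V u∈U v∈V ∷ []) ∷ [] ∷ []))))

      -- Two crossing edges have four distinct endpoints: on one line by the strict inequalities in
      -- `Cross`, across the lines by `U≢V`. So a crossing survives with probability (p / d) ^ 4,
      -- and other pairs contribute 0.
      𝔼-crossings : d ^ 4 * 𝔼 n chosenCrossings ≤ p ^ 4 * D * drawnCrossings
      𝔼-crossings = begin
        d ^ 4 * 𝔼 n chosenCrossings
          ≡⟨ 𝔼-∑-* (d ^ 4) uvEdges _ ⟩
        ∑[ e ← uvEdges ] d ^ 4 * 𝔼 n (λ σ → ∑[ f ← uvEdges ] both e f σ)
          ≡⟨ ∑-cong uvEdges (λ e → 𝔼-∑-* (d ^ 4) uvEdges (both e)) ⟩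
        ∑[ e ← uvEdges ] ∑[ f ← uvEdges ] d ^ 4 * 𝔼 n (both e f)
          ≤⟨ ∑-mono uvEdges (λ e∈ → ∑-mono uvEdges (λ f∈ → one e∈ f∈)) ⟩
        ∑[ e ← uvEdges ] ∑[ f ← uvEdges ] p ^ 4 * D * ⟦ cross? (e , f) ⟧
          ≡⟨ trans (∑-cong uvEdges λ _ → ∑-* (p ^ 4 * D) uvEdges) (∑-* (p ^ 4 * D) uvEdges) ⟩
        p ^ 4 * D * (∑[ e ← uvEdges ] ∑[ f ← uvEdges ] ⟦ cross? (e , f) ⟧)
          ≡⟨ cong (p ^ 4 * D *_) (trans (length-filter-∑ cross? (cartesianProduct uvEdges uvEdges))
                                        (∑-cartesianProduct uvEdges uvEdges)) ⟨
        p ^ 4 * D * drawnCrossings ∎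
        where
        open ≤-Reasoning
        both : Fin n × Fin n → Fin n × Fin n → Subset n → ℕ
        both e f σ = ⟦ chosen? σ e ⟧ * (⟦ chosen? σ f ⟧ * ⟦ cross? (e , f) ⟧)
        reassociate : ∀ a b c e → (a * b) * ((c * e) * 1) ≡ a * (b * (c * (e * 1)))
        reassociate = solve-∀
        one : ∀ {e f} → e ∈ uvEdges → f ∈ uvEdges → d ^ 4 * 𝔼 n (both e f) ≤ p ^ 4 * D * ⟦ cross? (e , f) ⟧
        one {e@(u , v)} {f@(u′ , v′)} e∈ f∈ with uvEdge-∈ e∈ | uvEdge-∈ f∈
        ... | u∈U , v∈V , _ | u′∈U , v′∈V , _ = by-cases (cross? (e , f))
          where
          by-cases : (x : Dec (Cross (e , f))) →
                     d ^ 4 * 𝔼 n (λ σ → ⟦ chosen? σ e ⟧ * (⟦ chosen? σ f ⟧ * ⟦ x ⟧)) ≤ p ^ 4 * D * ⟦ x ⟧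
          by-cases (no _) = ≤-trans (≤-reflexive (trans
            (cong (d ^ 4 *_) (trans (𝔼-cong n λ σ → trans (cong (⟦ chosen? σ e ⟧ *_) (*-zeroʳ ⟦ chosen? σ f ⟧))
              (*-zeroʳ ⟦ chosen? σ e ⟧)) (𝔼-0 n)))
            (*-zeroʳ (d ^ 4)))) z≤n
          by-cases (yes (pu<pu′ , pv′<pv)) = ≤-reflexive (trans
            (cong (d ^ 4 *_) (𝔼-cong n λ σ → trans
              (cong₂ (λ x y → x * (y * 1)) (⟦⟧-× (T? (σ u)) (T? (σ v))) (⟦⟧-× (T? (σ u′)) (T? (σ v′))))
              (reassociate ⟦ σ ∋ u ⟧ ⟦ σ ∋ v ⟧ ⟦ σ ∋ u′ ⟧ ⟦ σ ∋ v′ ⟧)))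
            (trans (𝔼-⊇ {xs = u ∷ v ∷ u′ ∷ v′ ∷ []}
              ((U≢V u∈U v∈V ∷ (λ { refl → <-irrefl refl pu<pu′ }) ∷ U≢V u∈U v′∈V ∷ []) ∷
               (≢-sym (U≢V u′∈U v∈V) ∷ (λ { refl → <-irrefl refl pv′<pv }) ∷ []) ∷
               (U≢V u′∈U v′∈V ∷ []) ∷ [] ∷ []))
              (sym (*-identityʳ (p ^ 4 * D)))))

      -- With π = p / d and M edges, averaging `chosen-bound` gives 6π²M ≤ π⁴χ + 10πn for χ drawn
      -- crossings; this is that inequality times d⁴ / p.
      sampled-bound : .{{NonZero p}} →
        6 * (d ^ 2 * (p * length uvEdges)) ≤ p ^ 3 * drawnCrossings + 10 * (d ^ 3 * n)
      sampled-bound = *-cancelˡ-≤ (p * D) {{m*n≢0 p D {{it}} {{m^n≢0 d n {{d-nonZero}}}}}} (begin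
        p * D * (6 * (d ^ 2 * (p * M)))                 ≡⟨ e₁ p D (d ^ 2) M ⟩
        6 * (d ^ 2 * (M * (p ^ 2 * D)))                 ≤⟨ *-monoʳ-≤ 6 (*-monoʳ-≤ (d ^ 2) 𝔼-edges) ⟩
        6 * (d ^ 2 * (d ^ 2 * Em))                      ≡⟨ e₂ d Em ⟩
        d ^ 4 * (6 * Em)                                ≤⟨ *-monoʳ-≤ (d ^ 4) averaged ⟩
        d ^ 4 * (Ec + 10 * 𝔼 n card)                    ≡⟨ e₃ d Ec (𝔼 n card) ⟩
        d ^ 4 * Ec + 10 * (d ^ 3 * (d * 𝔼 n card))      ≤⟨ +-mono-≤ 𝔼-crossings
                                                             (≤-reflexive (cong (λ z → 10 * (d ^ 3 * z)) 𝔼-card)) ⟩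
        p ^ 4 * D * cross + 10 * (d ^ 3 * (n * (p * D))) ≡⟨ e₄ p D cross (d ^ 3) n ⟩
        p * D * (p ^ 3 * cross + 10 * (d ^ 3 * n))      ∎)
        where
        open ≤-Reasoning
        d-nonZero : NonZero d
        d-nonZero = >-nonZero (≤-trans (>-nonZero⁻¹ p) (m≤m+n p q))
        M = length uvEdges
        cross = drawnCrossings
        Em = 𝔼 n (λ σ → ∑[ e ← uvEdges ] ⟦ chosen? σ e ⟧)
        Ec = 𝔼 n chosenCrossings
        averaged : 6 * Em ≤ Ec + 10 * 𝔼 n card
        averaged = begin
          6 * Em                          ≡⟨ 𝔼-* n 6 _ ⟨
          𝔼 n _                           ≤⟨ 𝔼-mono n chosen-bound ⟩
          𝔼 n _                           ≡⟨ 𝔼-+ n _ _ ⟩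
          Ec + 𝔼 n (λ σ → 10 * card σ)    ≡⟨ cong (Ec +_) (𝔼-* n 10 card) ⟩
          Ec + 10 * 𝔼 n card              ∎
        -- x ^ 2 is spelt x * (x * 1) to make these semiring identities.
        e₁ : ∀ p D d² M → p * D * (6 * (d² * (p * M))) ≡ 6 * (d² * (M * (p * (p * 1) * D)))
        e₁ = solve-∀
        e₂ : ∀ d E → 6 * (d * (d * 1) * (d * (d * 1) * E)) ≡ d * (d * (d * (d * 1))) * (6 * E)
        e₂ = solve-∀
        e₃ : ∀ d E K → d * (d * (d * (d * 1))) * (E + 10 * K) ≡
                       d * (d * (d * (d * 1))) * E + 10 * (d * (d * (d * 1)) * (d * K))
        e₃ = solve-∀
        e₄ : ∀ p D c d³ n → p * (p * (p * (p * 1))) * D * c + 10 * (d³ * (n * (p * D))) ≡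
                            p * D * (p * (p * (p * 1)) * c + 10 * (d³ * n))
        e₄ = solve-∀

  -- The choice of the sampling probability.

  crossing-bound : ∀ n m M χ .{{_ : NonZero n}} → m ≤ M →
    6 * ((48 * M) ^ 2 * (125 * n * M)) ≤ (125 * n) ^ 3 * χ + 10 * ((48 * M) ^ 3 * n) →
    4608 * m ^ 3 ≤ χ * (15625 * n ^ 2)
  crossing-bound n m M χ m≤M le = ≤-trans (*-monoʳ-≤ 4608 (^-monoˡ-≤ 3 m≤M))
    (*-cancelˡ-≤ (125 * n) {{m*n≢0 125 n}} (+-cancelʳ-≤ (10 * ((48 * M) ^ 3 * n)) _ _ (begin
      -- Here 6 · 48² · 125 = 1728000 and 125 · 4608 + 10 · 48³ = 1681920. The difference 46080 is
      -- what the constant 622080 / 1953125 has over 4608 / 15625 = 576000 / 1953125.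
      125 * n * (4608 * M ^ 3) + 10 * ((48 * M) ^ 3 * n)                ≤⟨ m≤m+n _ (46080 * (n * M ^ 3)) ⟩
      125 * n * (4608 * M ^ 3) + 10 * ((48 * M) ^ 3 * n) + 46080 * (n * M ^ 3)
        ≡⟨ e₁ n M ⟩
      6 * ((48 * M) ^ 2 * (125 * n * M))                                  ≤⟨ le ⟩
      (125 * n) ^ 3 * χ + 10 * ((48 * M) ^ 3 * n)                        ≡⟨ cong (_+ 10 * ((48 * M) ^ 3 * n)) (e₂ n χ) ⟩
      125 * n * (χ * (15625 * n ^ 2)) + 10 * ((48 * M) ^ 3 * n)        ∎)))
    where
    open ≤-Reasoning
    e₁ : ∀ n M → 125 * n * (4608 * (M * (M * (M * 1)))) +
                 10 * (48 * M * (48 * M * (48 * M * 1)) * n) + 46080 * (n * (M * (M * (M * 1)))) ≡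
                 6 * (48 * M * (48 * M * 1) * (125 * n * M))
    e₁ = solve-∀
    e₂ : ∀ n χ → 125 * n * (125 * n * (125 * n * 1)) * χ ≡ 125 * n * (χ * (15625 * (n * (n * 1))))
    e₂ = solve-∀

  -- An optimal drawing is sampled with p = 125n and q = 48M - 125n, hence with probability 125n /
  -- 48M. `dense` and `m≤M` make the truncated subtraction exact.
  crossingNumber-bound : ∀ {n} (G : Graph n) {k} .{{_ : NonZero n}} → IsCrossingNumber G k →
    let m = Graph.size G in 125 * n ≤ 48 * m → 4608 * m ^ 3 ≤ k * (15625 * n ^ 2)
  crossingNumber-bound {n} G ((𝒟 , refl) , _) dense = crossing-bound n m M k m≤M
    (subst (λ d → 6 * (d ^ 2 * (125 * n * M)) ≤ (125 * n) ^ 3 * k + 10 * (d ^ 3 * n))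
      (m+[n∸m]≡n (≤-trans dense (*-monoʳ-≤ 48 m≤M)))
      (sampled-bound 𝒟 (125 * n) (48 * M ∸ 125 * n) {{m*n≢0 125 n}}))
    where
    m = Graph.size G
    M = length (Drawing.uvEdges 𝒟)
    k = Drawing.crossings 𝒟
    m≤M = size≤uvEdges 𝒟

open Counting using (crossingNumber-bound)
open import Data.Nat using (ℕ; suc; NonZero; _^_) renaming (_≤_ to _≤ℕ_; _*_ to _*ℕ_)
open import Data.Integer using (+_)
open import Data.Rational using (_/_; _*_; _≤_; toℚᵘ)
import Data.Integer as ℤ
import Data.Integer.Properties as ℤ
import Data.Nat as ℕ
import Data.Nat.Properties as ℕ
open import Data.Product using (proj₂)
open import Data.Rational.Properties using (toℚᵘ-homo-*; toℚᵘ-fromℚᵘ; toℚᵘ-mono-≤; toℚᵘ-cancel-≤)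
open import Data.Rational.Unnormalised as ℚᵘ using (mkℚᵘ; *≤*)
import Data.Rational.Unnormalised.Properties as ℚᵘ
open import Relation.Binary.PropositionalEquality using (sym; trans; subst; subst₂)

-- Fractions

toℚᵘ-/ : ∀ a b .{{_ : NonZero b}} → toℚᵘ (+ a / b) ℚᵘ.≃ (+ a ℚᵘ./ b)
toℚᵘ-/ a (suc b) = toℚᵘ-fromℚᵘ (mkℚᵘ (+ a) b)

module _ (a b c d e : ℕ) .{{_ : NonZero b}} .{{_ : NonZero d}} where

  private
    product-≃ : toℚᵘ ((+ a / b) * (+ c / d)) ℚᵘ.≃ (+ a ℚᵘ./ b) ℚᵘ.* (+ c ℚᵘ./ d)
    product-≃ = ℚᵘ.≃-trans (toℚᵘ-homo-* (+ a / b) (+ c / d)) (ℚᵘ.*-cong (toℚᵘ-/ a b) (toℚᵘ-/ c d))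

  product≤⇒ : (+ a / b) * (+ c / d) ≤ + e / 1 → a *ℕ c ≤ℕ e *ℕ (b *ℕ d)
  product≤⇒ le = unnormalised b d
    (ℚᵘ.≤-respˡ-≃ product-≃ (ℚᵘ.≤-respʳ-≃ (toℚᵘ-/ e 1) (toℚᵘ-mono-≤ le)))
    where
    -- The denominators are fresh arguments here, so that matching them with `suc` lets the
    -- unnormalised fractions compute.
    unnormalised : ∀ b d .{{_ : NonZero b}} .{{_ : NonZero d}} →
      (+ a ℚᵘ./ b) ℚᵘ.* (+ c ℚᵘ./ d) ℚᵘ.≤ (+ e ℚᵘ./ 1) → a *ℕ c ≤ℕ e *ℕ (b *ℕ d)
    unnormalised (suc b) (suc d) (*≤* le) = ℤ.drop‿+≤+ (subst₂ ℤ._≤_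
      (trans (ℤ.*-identityʳ (+ a ℤ.* + c)) (sym (ℤ.pos-* a c))) (sym (ℤ.pos-* e (suc b *ℕ suc d))) le)

  product≤⇐ : a *ℕ c ≤ℕ e *ℕ (b *ℕ d) → (+ a / b) * (+ c / d) ≤ + e / 1
  product≤⇐ le = toℚᵘ-cancel-≤
    (ℚᵘ.≤-respˡ-≃ (ℚᵘ.≃-sym product-≃) (ℚᵘ.≤-respʳ-≃ (ℚᵘ.≃-sym (toℚᵘ-/ e 1)) (unnormalised b d le)))
    where
    unnormalised : ∀ b d .{{_ : NonZero b}} .{{_ : NonZero d}} →
      a *ℕ c ≤ℕ e *ℕ (b *ℕ d) → (+ a ℚᵘ./ b) ℚᵘ.* (+ c ℚᵘ./ d) ℚᵘ.≤ (+ e ℚᵘ./ 1)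
    unnormalised (suc b) (suc d) le = *≤* (subst₂ ℤ._≤_
      (trans (ℤ.pos-* a c) (sym (ℤ.*-identityʳ (+ a ℤ.* + c)))) (ℤ.pos-* e (suc b *ℕ suc d)) (ℤ.+≤+ le))

corollary1 : (n : ℕ) (G : Graph n) (bip : Bipartite G) (n≥4 : 4 ≤ℕ n) →
    let m = Graph.size G in
    (+ 125 / 48) * (+ n / 1) ≤ (+ m / 1) →
    (+ 4608 / 15625) * (_/_ (+ (m ^ 3)) (n ^ 2) {{n²-nonZero n≥4}}) ≤ (+ (cr G bip) / 1)
corollary1 n G bip n≥4 dense = product≤⇐ 4608 15625 (m ^ 3) (n ^ 2) (cr G bip) {{_}} {{n²-nonZero n≥4}}
  (crossingNumber-bound G {{n-nonZero}} (proj₂ (crossingNumber-exists G bip))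
    (subst (125 *ℕ n ≤ℕ_) (ℕ.*-comm m 48) (product≤⇒ 125 48 n 1 m dense)))
  where
  m = Graph.size G
  n-nonZero : NonZero n
  n-nonZero = ℕ.>-nonZero (ℕ.≤-trans (ℕ.s≤s ℕ.z≤n) n≥4)
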